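{- Let $n\ge1$, $r\ge1$ be integers, let $\beta\in\mathbb{Z}_n$, let $l=\gcd(n,\beta)$, and let $N_\beta$ be the number of matrices $X\in\mathrm{GL}_r(\mathbb{Z}_n)$ with $\mathrm{tr}\,X=\beta$. Then $$N_\beta=n^{r^2-1}\prod_{p\mid l}\left(\prod_{i=1}^r(1-p^{ -i})+(-1)^rp^{ -r(r+1)/2}(p-1)\right)\times\prod_{\substack{p\mid n\\ p\nmid l}}\left(\prod_{i=1}^r(1-p^{ -i})-(-1)^rp^{ -r(r+1)/2}\right),$$ where the products are over primes $p$.
   Context: $\mathbb{Z}_n=\mathbb{Z}/n\mathbb{Z}$ and $\mathrm{GL}_r(\mathbb{Z}_n)$ is the group of invertible $r\times r$ matrices over $\mathbb{Z}_n$; $\gcd(n,\beta)$ means the gcd of $n$ with any integer representative of $\beta$ (so $l=n$ when $\beta=0$). -}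

module Defs where

open import Data.Nat as ℕ using (ℕ; zero; suc; NonZero; ⌊_/2⌋)
open import Data.Nat.Properties using (m^n≢0)
open import Data.Nat.Divisibility using (_∣?_)
open import Data.Nat.Primality using (prime?)
open import Data.Nat.DivMod using (_mod_)
open import Data.Fin as Fin using (Fin; toℕ)
open import Data.Vec as Vec using (Vec; []; _∷_; lookup; tabulate)
open import Data.Vec.Properties using (≡-dec)
open import Data.List as List using (List; []; _∷_; _++_; concatMap; filter; length; allFin; upTo)
open import Data.List.Relation.Unary.Any using (Any; any?)
open import Data.Product using (_×_)
open import Relation.Binary.PropositionalEquality using (_≡_)
open import Relation.Nullary using (Dec; does; ¬?)
open import Relation.Nullary.Decidable using (_×-dec_)
open import Data.Bool using (if_then_else_)
open import Data.Integer using (+_)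
open import Data.Rational as ℚ using (ℚ; 0ℚ; 1ℚ; _/_)

-- r × r matrices over ℤ_n, ℤ_n represented by Fin n (residues 0..n-1)

Mat : ℕ → ℕ → Set
Mat r n = Vec (Vec (Fin n) r) r

entry : ∀ {r n} → Mat r n → Fin r → Fin r → Fin n
entry X i j = lookup (lookup X i) j

_·_ : ∀ {r n} .{{_ : NonZero n}} → Mat r n → Mat r n → Mat r n
_·_ {r} {n} X Y = tabulate λ i → tabulate λ j →
  (Vec.sum (tabulate λ k → toℕ (entry X i k) ℕ.* toℕ (entry Y k j))) mod n

idMat : ∀ r n .{{_ : NonZero n}} → Mat r n
idMat r n = tabulate λ i → tabulate λ j →
  if does (i Fin.≟ j) then (1 mod n) else (0 mod n)

tr : ∀ {r n} .{{_ : NonZero n}} → Mat r n → Fin n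
tr {r} {n} X = (Vec.sum (tabulate λ i → toℕ (entry X i i))) mod n

allVecs : ∀ {A : Set} (r : ℕ) → List A → List (Vec A r)
allVecs zero    xs = [] ∷ []
allVecs (suc r) xs = concatMap (λ x → List.map (x ∷_) (allVecs r xs)) xs

-- all r × r matrices over ℤ_n (each exactly once)
allMats : ∀ r n → List (Mat r n)
allMats r n = allVecs r (allVecs r (allFin n))

_≟M_ : ∀ {r n} (X Y : Mat r n) → Dec (X ≡ Y)
_≟M_ = ≡-dec (≡-dec Fin._≟_)

IsGL : ∀ {r n} .{{_ : NonZero n}} → Mat r n → Set
IsGL {r} {n} X = Any (λ Y → (X · Y ≡ idMat r n) × (Y · X ≡ idMat r n)) (allMats r n)

isGL? : ∀ {r n} .{{_ : NonZero n}} (X : Mat r n) → Dec (IsGL X)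
isGL? {r} {n} X = any? (λ Y → ((X · Y) ≟M idMat r n) ×-dec ((Y · X) ≟M idMat r n)) (allMats r n)

Nβ : ∀ r n .{{_ : NonZero n}} → Fin n → ℕ
Nβ r n β = length (filter (λ X → isGL? X ×-dec (tr X Fin.≟ β)) (allMats r n))

ℕ→ℚ : ℕ → ℚ
ℕ→ℚ k = (+ k) / 1

_^ℚ_ : ℚ → ℕ → ℚ
q ^ℚ zero  = 1ℚ
q ^ℚ suc k = q ℚ.* (q ^ℚ k)

invPow : (p : ℕ) .{{_ : NonZero p}} → ℕ → ℚ
invPow p k = _/_ (+ 1) (p ℕ.^ k) {{m^n≢0 p k}}

prodℚ : List ℚ → ℚ
prodℚ = List.foldr ℚ._*_ 1ℚ

prod1to : ℕ → (ℕ → ℚ) → ℚ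
prod1to r f = prodℚ (List.map (λ i → f (suc i)) (upTo r))

primesDividing : ℕ → List ℕ
primesDividing m =
  filter (λ p → prime? p ×-dec (p ∣? m)) (List.map suc (upTo m))

prodPrimes : (m : ℕ) → ((p : ℕ) → .{{NonZero p}} → ℚ) → ℚ
prodPrimes m f = prodℚ (List.map g (primesDividing m))
  where
  g : ℕ → ℚ
  g zero    = 0ℚ   -- never occurs: all listed p are ≥ 1
  g (suc q) = f (suc q)

prodPrimesNotDividing : (n l : ℕ) → ((p : ℕ) → .{{NonZero p}} → ℚ) → ℚ
prodPrimesNotDividing n l f =
  prodℚ (List.map g (filter (λ p → ¬? (p ∣? l)) (primesDividing n)))
  where
  g : ℕ → ℚ
  g zero    = 0ℚ
  g (suc q) = f (suc q)

{-# OPTIONS --safe #-}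

-- Over a finite ring a square matrix is invertible iff no nonzero row vector annihilates it,
-- and this replaces invertibility throughout.
-- Write N(n) for the number of invertible r × r matrices over ℤ/n with trace β.  If p is a
-- prime dividing m, reduction modulo m gives N(pm) = p^(r²-1) N(m); if p does not divide m,
-- the Chinese remainder theorem gives N(pm) = N(p) N(m).  This leaves n = p prime.
-- There, put a row v in front of r independent rows X of length r + 1.  The trace condition
-- prescribes the first entry of v, and v has to avoid the span of X.  On that span the first
-- entry is uniformly distributed, unless the first column of X is zero, in which case the other
-- columns of X form an invertible r × r matrix.  Hence
--   p N_{r+1} = |GL_{r+1}| + p^r |GL_r| - p^(r+1) N_r,
-- and by induction p N_r = |GL_r| + (-1)^r p^(r(r-1)/2) (p [β = 0] - 1).
module Submission where

open import Defs
open import Data.Nat as ℕ using (ℕ; zero; suc; NonZero; _≤_; _<_; _∸_; ⌊_/2⌋; s≤s; z≤n)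
import Data.Nat.Properties as ℕ
open import Data.Nat.DivMod
  using (_mod_; _%_; _/_; m%n<n; %-distribˡ-+; %-distribˡ-*; m<n⇒m%n≡m; n%n≡0; m*n%n≡0;
         m≡m%n+[m/n]*n; m∣n⇒o%n%m≡o%m; [m+kn]%n≡m%n)
open import Data.Nat.Divisibility
  using (_∣_; _∤_; _∣?_; divides; quotient; ∣-trans; m∣m*n; n∣m*n; ∣⇒≤; n∣m⇒m%n≡0; m%n≡0⇒n∣m)
open import Data.Nat.Primality
  using (Prime; prime?; prime⇒irreducible; prime⇒nonTrivial; prime⇒nonZero; euclidsLemma; ¬prime[1])
open import Data.Nat.Primality.Factorisation using (factorise; PrimeFactorisation)
open import Data.Nat.Coprimality as Coprime using (Coprime; coprime-Bézout; coprime-divisor)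
open import Data.Nat.GCD
  using (gcd; gcd[m,n]∣m; gcd[m,n]∣n; gcd-greatest; gcd[m,n]≢0; module Bézout)
open import Data.Nat.ListAction using (product)
open import Data.Nat.Solver using () renaming (module +-*-Solver to ℕ-Solver)
open import Data.Integer as ℤ using (ℤ; 0ℤ; 1ℤ)
import Data.Integer.Properties as ℤ
open import Data.Integer.Solver using () renaming (module +-*-Solver to ℤ-Solver)
import Data.Rational as ℚ
import Data.Rational.Properties as ℚ
import Data.Rational.Unnormalised as ℚᵘ
import Data.Rational.Unnormalised.Properties as ℚᵘ
open import Data.Rational.Solver using () renaming (module +-*-Solver to ℚ-Solver)
open import Data.Fin as Fin using (Fin; zero; suc; toℕ)
import Data.Fin.Properties as Fin
open import Data.Bool using (true; false; if_then_else_)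
open import Data.Vec as Vec using (Vec; []; _∷_; lookup; tabulate)
open import Data.Vec.Properties
  using (≡-dec; ∷-injectiveˡ; ∷-injectiveʳ; lookup∘tabulate; tabulate∘lookup; tabulate-cong;
         lookup-zipWith; lookup-replicate; lookup-map)
open import Data.List as List using (List; []; _∷_; _++_; concatMap; filter; length; allFin; upTo)
import Data.List.Properties as List
open import Data.List.Membership.Propositional using (_∈_)
open import Data.List.Relation.Unary.All as All using (All; []; _∷_)
open import Data.List.Relation.Unary.Any as Any using (Any; here; there)
open import Data.Product using (_×_; _,_; proj₁; proj₂; ∃)
open import Data.Sum using (inj₁; inj₂; [_,_]′)
open import Algebra.Bundles using (CommutativeRing)
open import Algebra.Properties.CommutativeSemigroup ℤ.+-commutativeSemigroup using (interchange)
open import Function using (_∘_; id)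
open import Relation.Binary.Definitions using (DecidableEquality)
open import Relation.Binary.PropositionalEquality
open import Relation.Nullary
open import Relation.Nullary.Decidable as Dec using (_×-dec_; _→-dec_; toSum)
open import Relation.Unary using (Decidable)

open ≡-Reasoning

-- The criterion by row vectors suits counting: an injective map from a finite set of rows to itself
-- is onto, so the coefficient rows that produce the unit vectors assemble into an inverse matrix.
-- It also makes sense for rectangular families, which appear as soon as one row is removed from a
-- square matrix.
--
-- The factor p^(r²-1) for p dividing m has two sources. The kernel of reduction from ℤ/pm to ℤ/m
-- has square zero, so a matrix is invertible once its reduction is. The trace condition fixes one
-- diagonal entry, and each of the other r²-1 entries has p lifts. If p does not divide m, the
-- kernel is not nilpotent and invertibility modulo p is a new condition. Primes are therefore split
-- off one at a time, with repetition, and only the first occurrence of a prime adds a factor to the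
-- product.
--
-- At a prime the counts stay multiplied by p, so that equidistribution of a nonzero linear form on
-- k coordinates reads p^k and every exponent is a natural number.
--
-- The prescribed trace is carried as a natural number, so one and the same value can be reduced
-- modulo every divisor of n.

private
  variable
    A B C P P′ : Set

module _ where

  open import Data.Integer using (_+_; _*_; -_; _-_)

  -- Sums over enumerations of finite sets

  sumOver : List A → (A → ℤ) → ℤ
  sumOver []       f = 0ℤ
  sumOver (x ∷ xs) f = f x + sumOver xs f

  sumOver-cong : ∀ (xs : List A) {f g : A → ℤ} → (∀ x → f x ≡ g x) → sumOver xs f ≡ sumOver xs g
  sumOver-cong []       f≗g = refl
  sumOver-cong (x ∷ xs) f≗g = cong₂ _+_ (f≗g x) (sumOver-cong xs f≗g)

  sumOver-++ : ∀ (xs ys : List A) f → sumOver (xs ++ ys) f ≡ sumOver xs f + sumOver ys f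
  sumOver-++ []       ys f = sym (ℤ.+-identityˡ _)
  sumOver-++ (x ∷ xs) ys f = trans (cong (f x +_) (sumOver-++ xs ys f)) (sym (ℤ.+-assoc (f x) _ _))

  sumOver-map : ∀ (g : A → B) xs f → sumOver (List.map g xs) f ≡ sumOver xs (f ∘ g)
  sumOver-map g []       f = refl
  sumOver-map g (x ∷ xs) f = cong (f (g x) +_) (sumOver-map g xs f)

  sumOver-concatMap : ∀ (g : A → List B) xs f →
                      sumOver (concatMap g xs) f ≡ sumOver xs (λ x → sumOver (g x) f)
  sumOver-concatMap g []       f = refl
  sumOver-concatMap g (x ∷ xs) f =
    trans (sumOver-++ (g x) (concatMap g xs) f)
        (cong (sumOver (g x) f +_) (sumOver-concatMap g xs f))

  sumOver-0 : ∀ (xs : List A) → sumOver xs (λ _ → 0ℤ) ≡ 0ℤ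
  sumOver-0 []       = refl
  sumOver-0 (x ∷ xs) = trans (ℤ.+-identityˡ _) (sumOver-0 xs)

  sumOver-+ : ∀ (xs : List A) f g → sumOver xs (λ x → f x + g x) ≡ sumOver xs f + sumOver xs g
  sumOver-+ []       f g = refl
  sumOver-+ (x ∷ xs) f g =
    trans (cong (f x + g x +_) (sumOver-+ xs f g)) (interchange (f x) (g x) _ _)

  sumOver-*ˡ : ∀ (xs : List A) c f → sumOver xs (λ x → c * f x) ≡ c * sumOver xs f
  sumOver-*ˡ []       c f = sym (ℤ.*-zeroʳ c)
  sumOver-*ˡ (x ∷ xs) c f =
    trans (cong (c * f x +_) (sumOver-*ˡ xs c f)) (sym (ℤ.*-distribˡ-+ c (f x) _))

  sumOver-*ʳ : ∀ (xs : List A) c f → sumOver xs (λ x → f x * c) ≡ sumOver xs f * c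
  sumOver-*ʳ xs c f =
    trans (sumOver-cong xs (λ x → ℤ.*-comm (f x) c)) (trans (sumOver-*ˡ xs c f) (ℤ.*-comm c _))

  sumOver-- : ∀ (xs : List A) f g → sumOver xs (λ x → f x - g x) ≡ sumOver xs f - sumOver xs g
  sumOver-- []       f g = refl
  sumOver-- (x ∷ xs) f g =
    trans (cong (f x - g x +_) (sumOver-- xs f g))
          (trans (interchange (f x) (- g x) _ _)
            (cong (f x + sumOver xs f +_) (sym (ℤ.neg-distrib-+ (g x) _))))

  sumOver-swap : ∀ (xs : List A) (ys : List B) (f : A → B → ℤ) →
                 sumOver xs (λ x → sumOver ys (f x)) ≡ sumOver ys (λ y → sumOver xs (λ x → f x y))
  sumOver-swap []       ys f = sym (sumOver-0 ys)
  sumOver-swap (x ∷ xs) ys f =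
    trans (cong (sumOver ys (f x) +_) (sumOver-swap xs ys f)) (sym (sumOver-+ ys (f x) _))

  sumOver-allVecs : ∀ k (xs : List A) (f : Vec A (suc k) → ℤ) →
                    sumOver (allVecs (suc k) xs) f
                    ≡ sumOver xs (λ x → sumOver (allVecs k xs) (λ v → f (x ∷ v)))
  sumOver-allVecs k xs f =
    trans (sumOver-concatMap _ xs f) (sumOver-cong xs (λ x → sumOver-map (x ∷_) (allVecs k xs) f))

  -- Counts are sums of these indicators. The values lie in ℤ so that a complement can be counted by
  -- subtraction.
  ind : Dec P → ℤ
  ind d = if does d then 1ℤ else 0ℤ

  ind-yes : ∀ (d : Dec P) → P → ind d ≡ 1ℤ
  ind-yes (yes _) p = refl
  ind-yes (no ¬p) p = contradiction p ¬p

  ind-no : ∀ (d : Dec P) → ¬ P → ind d ≡ 0ℤ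
  ind-no (yes p) ¬p = contradiction p ¬p
  ind-no (no _)  ¬p = refl

  ind-cong : ∀ (d : Dec P) (e : Dec P′) → (P → P′) → (P′ → P) → ind d ≡ ind e
  ind-cong (yes p) e f g = sym (ind-yes e (f p))
  ind-cong (no ¬p) e f g = sym (ind-no e (¬p ∘ g))

  ind-× : ∀ (d : Dec P) (e : Dec P′) → ind (d ×-dec e) ≡ ind d * ind e
  ind-× (yes _) (yes _) = refl
  ind-× (yes _) (no _)  = refl
  ind-× (no _)  (yes _) = refl
  ind-× (no _)  (no _)  = refl

  ind-¬ : ∀ (d : Dec P) → ind (¬? d) ≡ 1ℤ - ind d
  ind-¬ (yes _) = refl
  ind-¬ (no _)  = refl

  ind-*-cong : ∀ (d : Dec P) {a b} → (P → a ≡ b) → ind d * a ≡ ind d * b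
  ind-*-cong (yes p) eq = cong (1ℤ *_) (eq p)
  ind-*-cong (no _)  eq = refl

  length-filter-ind : ∀ {P : A → Set} (P? : Decidable P) xs →
                      ℤ.+ length (filter P? xs) ≡ sumOver xs (ind ∘ P?)
  length-filter-ind P? [] = refl
  length-filter-ind P? (x ∷ xs) with P? x
  ... | yes _ = trans (ℤ.pos-+ 1 _) (cong (1ℤ +_) (length-filter-ind P? xs))
  ... | no _  = trans (length-filter-ind P? xs) (sym (ℤ.+-identityˡ _))

  -- The field `once` encodes completeness and absence of repetition in a single sum, the form in
  -- which it is used to collapse sums against a delta.
  record Enumeration (A : Set) : Set where
    field
      _≟_   : DecidableEquality A
      elems : List A
      once  : ∀ b → sumOver elems (λ x → ind (x ≟ b)) ≡ 1ℤ

    sum : (A → ℤ) → ℤ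
    sum = sumOver elems

    sum-pick : ∀ b (h : A → ℤ) → sum (λ x → ind (x ≟ b) * h x) ≡ h b
    sum-pick b h = begin
      sum (λ x → ind (x ≟ b) * h x) ≡⟨ sumOver-cong elems (λ x → ind-*-cong (x ≟ b) (cong h)) ⟩
      sum (λ x → ind (x ≟ b) * h b) ≡⟨ sumOver-*ʳ elems (h b) _ ⟩
      sum (λ x → ind (x ≟ b)) * h b ≡⟨ cong (_* h b) (once b) ⟩
      1ℤ * h b                      ≡⟨ ℤ.*-identityˡ _ ⟩
      h b                           ∎

    sum-unique : ∀ {P : A → Set} (P? : Decidable P) b → (∀ x → P x → x ≡ b) → P b →
                 sum (ind ∘ P?) ≡ 1ℤ
    sum-unique P? b unique Pb =
      trans (sumOver-cong elems (λ x → ind-cong (P? x) (x ≟ b) (unique x) (λ { refl → Pb })))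
            (once b)

    complete : ∀ b → b ∈ elems
    complete b = go elems (λ eq → case-0≡1 (trans (sym eq) (once b)))
      where
      case-0≡1 : 0ℤ ≢ 1ℤ
      case-0≡1 ()
      go : ∀ xs → sumOver xs (λ x → ind (x ≟ b)) ≢ 0ℤ → b ∈ xs
      go []       ≢0 = contradiction refl ≢0
      go (x ∷ xs) ≢0 with x ≟ b
      ... | yes refl = here refl
      ... | no _     = there (go xs (λ eq → ≢0 (trans (ℤ.+-identityˡ _) eq)))

    exists? : ∀ {P : A → Set} → Decidable P → Dec (∃ P)
    exists? P? = Dec.map′ Any.satisfied (λ (x , Px) → Any.map (λ { refl → Px }) (complete x))
                          (Any.any? P? elems)

    forall? : ∀ {P : A → Set} → Decidable P → Dec (∀ x → P x)
    forall? P? = Dec.map′ (λ ps x → All.lookup ps (complete x)) (λ ps → All.universal ps elems)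
                          (All.all? P? elems)

    -- Integer summands might cancel in general. These cannot, because their sum is the length of a
    -- filtered list.
    ind-sum-zero : ∀ {P : A → Set} (P? : Decidable P) → sum (ind ∘ P?) ≡ 0ℤ → ∀ x → ¬ P x
    ind-sum-zero P? eq x = go elems count≡0 (complete x)
      where
      count≡0 : length (filter P? elems) ≡ 0
      count≡0 = ℤ.+-injective (trans (length-filter-ind P? elems) eq)
      go : ∀ xs → length (filter P? xs) ≡ 0 → x ∈ xs → ¬ _
      go (y ∷ xs) eq x∈ Px with P? y
      go (y ∷ xs) () x∈ Px | yes _
      go (y ∷ xs) eq (here refl) Px | no ¬Py = ¬Py Px
      go (y ∷ xs) eq (there x∈)  Px | no _   = go xs eq x∈ Px

    size : ℤ
    size = sum (λ _ → 1ℤ)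

    sum-const : ∀ c → sum (λ _ → c) ≡ size * c
    sum-const c = trans (sumOver-cong elems (λ _ → sym (ℤ.*-identityˡ c))) (sumOver-*ʳ elems c _)

  module _ (E : Enumeration A) where
    open Enumeration E

    vecs : ∀ k → Enumeration (Vec A k)
    vecs k = record { _≟_ = ≡-dec _≟_ ; elems = allVecs k elems ; once = once-vec k }
      where
      once-vec : ∀ k w → sumOver (allVecs k elems) (λ v → ind (≡-dec _≟_ v w)) ≡ 1ℤ
      once-vec zero    []      = refl
      once-vec (suc k) (b ∷ w) = begin
        sumOver (allVecs (suc k) elems) (λ v → ind (≡-dec _≟_ v (b ∷ w)))
          ≡⟨ sumOver-allVecs k elems _ ⟩
        sum (λ x → sumOver (allVecs k elems) (λ v → ind (≡-dec _≟_ (x ∷ v) (b ∷ w))))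
          ≡⟨ sumOver-cong elems (λ x → sumOver-cong (allVecs k elems) (λ v →
               ind-× (x ≟ b) (≡-dec _≟_ v w))) ⟩
        sum (λ x → sumOver (allVecs k elems) (λ v → ind (x ≟ b) * ind (≡-dec _≟_ v w)))
          ≡⟨ sumOver-cong elems (λ x → trans (sumOver-*ˡ (allVecs k elems) (ind (x ≟ b)) _)
               (trans (cong (ind (x ≟ b) *_) (once-vec k w)) (ℤ.*-identityʳ _))) ⟩
        sum (λ x → ind (x ≟ b))
          ≡⟨ once b ⟩
        1ℤ ∎

    size-vecs : ∀ k → Enumeration.size (vecs k) ≡ size ℤ.^ k
    size-vecs zero    = refl
    size-vecs (suc k) = begin
      sumOver (allVecs (suc k) elems) (λ _ → 1ℤ)           ≡⟨ sumOver-allVecs k elems _ ⟩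
      sum (λ _ → sumOver (allVecs k elems) (λ _ → 1ℤ))     ≡⟨ sum-const _ ⟩
      size * sumOver (allVecs k elems) (λ _ → 1ℤ)          ≡⟨ cong (size *_) (size-vecs k) ⟩
      size * size ℤ.^ k                                    ∎

  fins : ∀ n → Enumeration (Fin n)
  fins n = record { _≟_ = Fin._≟_ ; elems = allFin n ; once = once-fin }
    where
    allFin-suc : ∀ n f → sumOver (allFin (suc n)) f ≡ f zero + sumOver (allFin n) (f ∘ suc)
    allFin-suc n f = cong (f zero +_)
      (trans (cong (λ xs → sumOver xs f) (sym (List.map-tabulate id suc)))
        (sumOver-map suc (allFin n) f))
    once-fin : ∀ {n} (b : Fin n) → sumOver (allFin n) (λ x → ind (x Fin.≟ b)) ≡ 1ℤ
    once-fin {suc n} zero = begin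
      sumOver (allFin (suc n)) (λ x → ind (x Fin.≟ zero))
          ≡⟨ allFin-suc n (λ x → ind (x Fin.≟ zero)) ⟩
      1ℤ + sumOver (allFin n) (λ x → ind (suc x Fin.≟ zero))
          ≡⟨ cong (1ℤ +_) (sumOver-0 (allFin n)) ⟩
      1ℤ                                                        ∎
    once-fin {suc n} (suc b) = begin
      sumOver (allFin (suc n)) (λ x → ind (x Fin.≟ suc b))
          ≡⟨ allFin-suc n (λ x → ind (x Fin.≟ suc b)) ⟩
      0ℤ + sumOver (allFin n) (λ x → ind (suc x Fin.≟ suc b))   ≡⟨ ℤ.+-identityˡ _ ⟩
      sumOver (allFin n) (λ x → ind (suc x Fin.≟ suc b))
        ≡⟨ sumOver-cong (allFin n) (λ x → ind-cong (suc x Fin.≟ suc b) (x Fin.≟ b) Fin.suc-injective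
          (cong suc)) ⟩
      sumOver (allFin n) (λ x → ind (x Fin.≟ b))                ≡⟨ once-fin b ⟩
      1ℤ                                                        ∎

  size-fins : ∀ n → Enumeration.size (fins n) ≡ ℤ.+ n
  size-fins n = trans (go (allFin n)) (cong ℤ.+_ (List.length-tabulate {n = n} id))
    where
    go : ∀ {A : Set} (xs : List A) → sumOver xs (λ _ → 1ℤ) ≡ ℤ.+ length xs
    go []       = refl
    go (x ∷ xs) = trans (cong (1ℤ +_) (go xs)) (sym (ℤ.pos-+ 1 (length xs)))

  -- π and ρ identify the type C, as far as sums are concerned, with the product of A and B.
  SplitsAs : List C → (C → A) → (C → B) → List A → List B → Set
  SplitsAs {A = A} {B = B} zs π ρ xs ys = ∀ (F : A → B → ℤ) → sumOver zs (λ z → F (π z) (ρ z)) ≡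
      sumOver xs (λ x → sumOver ys (F x))

  -- Insert a delta for each of the two coordinates and exchange the sums. The inner sum over `z`
  -- then counts the fibre above `x` and `y`, which consists of `pair x y` alone.
  splits : ∀ (EA : Enumeration A) (EB : Enumeration B) (EC : Enumeration C)
           (π : C → A) (ρ : C → B) (pair : A → B → C) →
           (∀ x y → π (pair x y) ≡ x) → (∀ x y → ρ (pair x y) ≡ y) →
           (∀ z z′ → π z ≡ π z′ → ρ z ≡ ρ z′ → z ≡ z′) →
           SplitsAs (Enumeration.elems EC) π ρ (Enumeration.elems EA) (Enumeration.elems EB)
  splits EA EB EC π ρ pair π-pair ρ-pair joint F = begin
    C.sum (λ z → F (π z) (ρ z))
      ≡⟨ sumOver-cong C.elems (λ z → trans (sym (A.sum-pick (π z) (λ x → F x (ρ z))))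
           (sumOver-cong A.elems λ x → cong (ind (x A.≟ π z) *_) (sym (B.sum-pick (ρ z) (F x))))) ⟩
    C.sum (λ z → A.sum (λ x → ind (x A.≟ π z) * B.sum (λ y → ind (y B.≟ ρ z) * F x y)))
      ≡⟨ sumOver-swap C.elems A.elems _ ⟩
    A.sum (λ x → C.sum (λ z → ind (x A.≟ π z) * B.sum (λ y → ind (y B.≟ ρ z) * F x y)))
      ≡⟨ sumOver-cong A.elems (λ x → sumOver-cong C.elems λ z →
           sym (sumOver-*ˡ B.elems (ind (x A.≟ π z)) _)) ⟩
    A.sum (λ x → C.sum (λ z → B.sum (λ y → ind (x A.≟ π z) * (ind (y B.≟ ρ z) * F x y))))
      ≡⟨ sumOver-cong A.elems (λ x → sumOver-swap C.elems B.elems _) ⟩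
    A.sum (λ x → B.sum (λ y → C.sum (λ z → ind (x A.≟ π z) * (ind (y B.≟ ρ z) * F x y))))
      ≡⟨ sumOver-cong A.elems (λ x → sumOver-cong B.elems λ y → fibre x y) ⟩
    A.sum (λ x → B.sum (F x)) ∎
    where
    module A = Enumeration EA
    module B = Enumeration EB
    module C = Enumeration EC
    fibre : ∀ x y → C.sum (λ z → ind (x A.≟ π z) * (ind (y B.≟ ρ z) * F x y)) ≡ F x y
    fibre x y = begin
      C.sum (λ z → ind (x A.≟ π z) * (ind (y B.≟ ρ z) * F x y))
        ≡⟨ sumOver-cong C.elems (λ z → trans (sym (ℤ.*-assoc (ind (x A.≟ π z)) _ _))
             (cong (_* F x y) (sym (ind-× (x A.≟ π z) (y B.≟ ρ z))))) ⟩
      C.sum (λ z → ind ((x A.≟ π z) ×-dec (y B.≟ ρ z)) * F x y)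
        ≡⟨ sumOver-*ʳ C.elems (F x y) _ ⟩
      C.sum (λ z → ind ((x A.≟ π z) ×-dec (y B.≟ ρ z))) * F x y
        ≡⟨ cong (_* F x y) (C.sum-unique (λ z → (x A.≟ π z) ×-dec (y B.≟ ρ z)) (pair x y)
             (λ { z (x≡ , y≡) → joint z (pair x y) (trans (sym x≡) (sym (π-pair x y)))
                                                   (trans (sym y≡) (sym (ρ-pair x y))) })
             (sym (π-pair x y) , sym (ρ-pair x y))) ⟩
      1ℤ * F x y
        ≡⟨ ℤ.*-identityˡ _ ⟩
      F x y ∎

  -- Heads split by hypothesis and tails by induction; exchanging the sum over second heads with the
  -- sum over first tails regroups them into two vectors.
  splits-vecs : ∀ {π : C → A} {ρ : C → B} {zs xs ys} → SplitsAs zs π ρ xs ys →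
                ∀ k → SplitsAs (allVecs k zs) (Vec.map π) (Vec.map ρ) (allVecs k xs) (allVecs k ys)
  splits-vecs s zero    F = sym (trans (ℤ.+-identityʳ _) refl)
  splits-vecs {π = π} {ρ} {zs} {xs} {ys} s (suc k) F = begin
    sumOver (allVecs (suc k) zs) (λ v → F (Vec.map π v) (Vec.map ρ v))
      ≡⟨ sumOver-allVecs k zs _ ⟩
    sumOver zs (λ z → sumOver (allVecs k zs) (λ v → F (π z ∷ Vec.map π v) (ρ z ∷ Vec.map ρ v)))
      ≡⟨ sumOver-cong zs (λ z → splits-vecs s k (λ a b → F (π z ∷ a) (ρ z ∷ b))) ⟩
    sumOver zs (λ z → sumOver (allVecs k xs)
        (λ a → sumOver (allVecs k ys) (λ b → F (π z ∷ a) (ρ z ∷ b))))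
      ≡⟨ s (λ x y → sumOver (allVecs k xs) (λ a → sumOver (allVecs k ys) (λ b → F (x ∷ a) (y ∷ b)))) ⟩
    sumOver xs (λ x → sumOver ys (λ y → sumOver (allVecs k xs)
        (λ a → sumOver (allVecs k ys) (λ b → F (x ∷ a) (y ∷ b)))))
      ≡⟨ sumOver-cong xs (λ x → trans (sumOver-swap ys (allVecs k xs) _)
           (sumOver-cong (allVecs k xs) λ a → sym (sumOver-allVecs k ys _))) ⟩
    sumOver xs (λ x → sumOver (allVecs k xs) (λ a → sumOver (allVecs (suc k) ys) (F (x ∷ a))))
      ≡⟨ sumOver-allVecs k xs _ ⟨
    sumOver (allVecs (suc k) xs) (λ a → sumOver (allVecs (suc k) ys) (F a)) ∎

  -- The ring of residues modulo n

  toℕ-mod : ∀ a n .{{_ : NonZero n}} → toℕ (a mod n) ≡ a % n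
  toℕ-mod a n = Fin.toℕ-fromℕ< (m%n<n a n)

  mod-cong : ∀ n .{{_ : NonZero n}} {a b} → a % n ≡ b % n → a mod n ≡ b mod n
  mod-cong n {a} {b} eq = Fin.toℕ-injective (trans (toℕ-mod a n) (trans eq (sym (toℕ-mod b n))))

  mod-injective : ∀ n .{{_ : NonZero n}} {a b} → a mod n ≡ b mod n → a % n ≡ b % n
  mod-injective n {a} {b} eq = trans (sym (toℕ-mod a n)) (trans (cong toℕ eq) (toℕ-mod b n))

  mod-toℕ : ∀ {n} .{{_ : NonZero n}} (x : Fin n) → toℕ x mod n ≡ x
  mod-toℕ {n} x = Fin.toℕ-injective (trans (toℕ-mod (toℕ x) n) (m<n⇒m%n≡m (Fin.toℕ<n x)))

  module Residues (n : ℕ) .{{_ : NonZero n}} where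

    infixl 6 _⊕_
    infixl 7 _⊗_

    _⊕_ _⊗_ : Fin n → Fin n → Fin n
    x ⊕ y = (toℕ x ℕ.+ toℕ y) mod n
    x ⊗ y = (toℕ x ℕ.* toℕ y) mod n

    neg : Fin n → Fin n
    neg x = (n ℕ.∸ toℕ x) mod n

    -- Written as reductions to agree with the entries of `idMat`; modulo 1 the two coincide.
    0# 1# : Fin n
    0# = 0 mod n
    1# = 1 mod n

    mod-+ : ∀ a b → (a ℕ.+ b) mod n ≡ a mod n ⊕ b mod n
    mod-+ a b = mod-cong n (trans (%-distribˡ-+ a b n)
      (sym (cong₂ (λ u v → (u ℕ.+ v) % n) (toℕ-mod a n) (toℕ-mod b n))))

    mod-* : ∀ a b → (a ℕ.* b) mod n ≡ (a mod n) ⊗ (b mod n)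
    mod-* a b = mod-cong n (trans (%-distribˡ-* a b n)
      (sym (cong₂ (λ u v → (u ℕ.* v) % n) (toℕ-mod a n) (toℕ-mod b n))))

    ⊕-assoc : ∀ x y z → (x ⊕ y) ⊕ z ≡ x ⊕ (y ⊕ z)
    ⊕-assoc x y z = begin
      (x ⊕ y) ⊕ z                                 ≡⟨ cong ((x ⊕ y) ⊕_) (mod-toℕ z) ⟨
      (toℕ x ℕ.+ toℕ y) mod n ⊕ toℕ z mod n       ≡⟨ mod-+ (toℕ x ℕ.+ toℕ y) (toℕ z) ⟨
      (toℕ x ℕ.+ toℕ y ℕ.+ toℕ z) mod n           ≡⟨ cong (_mod n) (ℕ.+-assoc (toℕ x) _ _) ⟩
      (toℕ x ℕ.+ (toℕ y ℕ.+ toℕ z)) mod n         ≡⟨ mod-+ (toℕ x) (toℕ y ℕ.+ toℕ z) ⟩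
      toℕ x mod n ⊕ (y ⊕ z)                       ≡⟨ cong (_⊕ (y ⊕ z)) (mod-toℕ x) ⟩
      x ⊕ (y ⊕ z)                                 ∎

    ⊗-assoc : ∀ x y z → (x ⊗ y) ⊗ z ≡ x ⊗ (y ⊗ z)
    ⊗-assoc x y z = begin
      (x ⊗ y) ⊗ z                                 ≡⟨ cong ((x ⊗ y) ⊗_) (mod-toℕ z) ⟨
      (toℕ x ℕ.* toℕ y) mod n ⊗ (toℕ z mod n)       ≡⟨ mod-* (toℕ x ℕ.* toℕ y) (toℕ z) ⟨
      (toℕ x ℕ.* toℕ y ℕ.* toℕ z) mod n           ≡⟨ cong (_mod n) (ℕ.*-assoc (toℕ x) _ _) ⟩
      (toℕ x ℕ.* (toℕ y ℕ.* toℕ z)) mod n         ≡⟨ mod-* (toℕ x) (toℕ y ℕ.* toℕ z) ⟩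
      toℕ x mod n ⊗ (y ⊗ z)                       ≡⟨ cong (_⊗ (y ⊗ z)) (mod-toℕ x) ⟩
      x ⊗ (y ⊗ z)                                 ∎

    ⊕-comm : ∀ x y → x ⊕ y ≡ y ⊕ x
    ⊕-comm x y = cong (_mod n) (ℕ.+-comm (toℕ x) (toℕ y))

    ⊗-comm : ∀ x y → x ⊗ y ≡ y ⊗ x
    ⊗-comm x y = cong (_mod n) (ℕ.*-comm (toℕ x) (toℕ y))

    ⊗-distribˡ-⊕ : ∀ x y z → x ⊗ (y ⊕ z) ≡ x ⊗ y ⊕ x ⊗ z
    ⊗-distribˡ-⊕ x y z = begin
      x ⊗ (y ⊕ z)                                  ≡⟨ cong (_⊗ (y ⊕ z)) (mod-toℕ x) ⟨
      toℕ x mod n ⊗ ((toℕ y ℕ.+ toℕ z) mod n)       ≡⟨ mod-* (toℕ x) (toℕ y ℕ.+ toℕ z) ⟨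
      (toℕ x ℕ.* (toℕ y ℕ.+ toℕ z)) mod n          ≡⟨ cong (_mod n) (ℕ.*-distribˡ-+ (toℕ x) _ _) ⟩
      (toℕ x ℕ.* toℕ y ℕ.+ toℕ x ℕ.* toℕ z) mod n  ≡⟨ mod-+ (toℕ x ℕ.* toℕ y) (toℕ x ℕ.* toℕ z) ⟩
      x ⊗ y ⊕ x ⊗ z                                ∎

    ⊕-identityˡ : ∀ x → 0# ⊕ x ≡ x
    ⊕-identityˡ x = begin
      0# ⊕ x              ≡⟨ cong (0# ⊕_) (mod-toℕ x) ⟨
      0# ⊕ toℕ x mod n    ≡⟨ mod-+ 0 (toℕ x) ⟨
      toℕ x mod n         ≡⟨ mod-toℕ x ⟩
      x                   ∎

    ⊗-identityˡ : ∀ x → 1# ⊗ x ≡ x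
    ⊗-identityˡ x = begin
      1# ⊗ x                   ≡⟨ cong (1# ⊗_) (mod-toℕ x) ⟨
      1# ⊗ (toℕ x mod n)       ≡⟨ mod-* 1 (toℕ x) ⟨
      (1 ℕ.* toℕ x) mod n      ≡⟨ cong (_mod n) (ℕ.*-identityˡ (toℕ x)) ⟩
      toℕ x mod n              ≡⟨ mod-toℕ x ⟩
      x                        ∎

    neg-inverseˡ : ∀ x → neg x ⊕ x ≡ 0#
    neg-inverseˡ x = begin
      neg x ⊕ x                          ≡⟨ cong (neg x ⊕_) (mod-toℕ x) ⟨
      neg x ⊕ toℕ x mod n                ≡⟨ mod-+ (n ℕ.∸ toℕ x) (toℕ x) ⟨
      (n ℕ.∸ toℕ x ℕ.+ toℕ x) mod n      ≡⟨ cong (_mod n) (ℕ.m∸n+n≡m (ℕ.<⇒≤ (Fin.toℕ<n x))) ⟩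
      n mod n                            ≡⟨ mod-cong n {n} {0}
          (trans (n%n≡0 n) (sym (m<n⇒m%n≡m (ℕ.>-nonZero⁻¹ n)))) ⟩
      0#                                 ∎

    comm⇒ʳ : ∀ {_∙_ : Fin n → Fin n → Fin n} {e} → (∀ x y → x ∙ y ≡ y ∙ x) → (∀ x → e ∙ x ≡ x) → ∀ x
        → x ∙ e ≡ x
    comm⇒ʳ comm idˡ x = trans (comm x _) (idˡ x)

    residueRing : CommutativeRing _ _
    residueRing = record
      { Carrier = Fin n ; _≈_ = _≡_ ; _+_ = _⊕_ ; _*_ = _⊗_ ; -_ = neg ; 0# = 0# ; 1# = 1#
      ; isCommutativeRing = record
        { isRing = record
          { +-isAbelianGroup = record
            { isGroup = record
              { isMonoid = record
                { isSemigroup = record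
                  { isMagma = isMagma _⊕_
                  ; assoc = ⊕-assoc
                  }
                ; identity = ⊕-identityˡ , comm⇒ʳ ⊕-comm ⊕-identityˡ
                }
              ; inverse = neg-inverseˡ , λ x → trans (⊕-comm x (neg x)) (neg-inverseˡ x)
              ; ⁻¹-cong = cong neg
              }
            ; comm = ⊕-comm
            }
          ; *-cong = cong₂ _⊗_
          ; *-assoc = ⊗-assoc
          ; *-identity = ⊗-identityˡ , comm⇒ʳ ⊗-comm ⊗-identityˡ
          ; distrib = ⊗-distribˡ-⊕ , λ x y z → trans (⊗-comm (y ⊕ z) x)
                        (trans (⊗-distribˡ-⊕ x y z) (cong₂ _⊕_ (⊗-comm x y) (⊗-comm x z)))
          }
        ; *-comm = ⊗-comm
        }
      }
      where open import Relation.Binary.PropositionalEquality.Algebra using (isMagma)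

  -- Row vectors times matrices

  lookup-ext : ∀ {A : Set} {k} {u v : Vec A k} → (∀ i → lookup u i ≡ lookup v i) → u ≡ v
  lookup-ext {u = u} {v} eq = trans (sym (tabulate∘lookup u))
      (trans (tabulate-cong eq) (tabulate∘lookup v))

  module Rows (n : ℕ) .{{_ : NonZero n}} where

    open Residues n
    module R = CommutativeRing residueRing
    open import Algebra.Properties.Semiring.Sum R.semiring public
      using (sum; sum-cong-≗; ∑-comm; ∑-distrib-+; *-distribˡ-sum; *-distribʳ-sum;
             sum-replicate-zero)
    open import Algebra.Properties.Ring R.ring public using (-1*x≈-x)
    open import Algebra.Properties.Group R.+-group public using
        (x∙y⁻¹≈ε⇒x≈y; inverseˡ-unique; inverseʳ-unique)

    private
      variable
        k l m : ℕ

    Row : ℕ → Set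
    Row l = Vec (Fin n) l

    sum-zero : ∀ (f : Fin k → Fin n) → (∀ i → f i ≡ 0#) → sum f ≡ 0#
    sum-zero {k} f f≗0 = trans (sum-cong-≗ f≗0) (sum-replicate-zero k)

    sum-δ : ∀ (f : Fin k → Fin n) i → sum (λ j → (if does (i Fin.≟ j) then 1# else 0#) ⊗ f j) ≡ f i
    sum-δ f zero = begin
      1# ⊗ f zero ⊕ sum (λ j → 0# ⊗ f (suc j))
          ≡⟨ cong₂ _⊕_ (R.*-identityˡ (f zero)) (sum-zero _ (λ j → R.zeroˡ (f (suc j)))) ⟩
      f zero ⊕ 0#                              ≡⟨ R.+-identityʳ _ ⟩
      f zero                                   ∎
    sum-δ f (suc i) = begin
      0# ⊗ f zero ⊕ sum (λ j → (if does (i Fin.≟ j) then 1# else 0#) ⊗ f (suc j))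
        ≡⟨ cong₂ _⊕_ (R.zeroˡ (f zero)) (sum-δ (f ∘ suc) i) ⟩
      0# ⊕ f (suc i) ≡⟨ R.+-identityˡ _ ⟩
      f (suc i) ∎

    sum-δʳ : ∀ (f : Fin k → Fin n) i → sum (λ j → f j ⊗ (if does (j Fin.≟ i) then 1# else 0#)) ≡ f i
    sum-δʳ f zero = begin
      f zero ⊗ 1# ⊕ sum (λ j → f (suc j) ⊗ 0#)
          ≡⟨ cong₂ _⊕_ (R.*-identityʳ (f zero)) (sum-zero _ (λ j → R.zeroʳ (f (suc j)))) ⟩
      f zero ⊕ 0#                              ≡⟨ R.+-identityʳ _ ⟩
      f zero                                   ∎
    sum-δʳ f (suc i) = begin
      f zero ⊗ 0# ⊕ sum (λ j → f (suc j) ⊗ (if does (j Fin.≟ i) then 1# else 0#))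
        ≡⟨ cong₂ _⊕_ (R.zeroʳ (f zero)) (sum-δʳ (f ∘ suc) i) ⟩
      0# ⊕ f (suc i) ≡⟨ R.+-identityˡ _ ⟩
      f (suc i) ∎

    -- Bridge from `tr` and `_·_`, which add natural numbers and reduce once at the end, to ring
    -- sums, which reduce at every step.
    sum-mod : ∀ (f : Fin k → ℕ) → Vec.sum (tabulate f) mod n ≡ sum (λ i → f i mod n)
    sum-mod {zero}  f = refl
    sum-mod {suc k} f = trans (mod-+ (f zero) _) (cong (f zero mod n ⊕_) (sum-mod (f ∘ suc)))

    0v : Row l
    0v {l} = Vec.replicate l 0#

    lookup-0v : ∀ (i : Fin l) → lookup 0v i ≡ 0#
    lookup-0v i = lookup-replicate i 0#

    infixl 7 _⊛_

    -- Row vector times matrix, equally the linear combination of the rows of `X` with coefficients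
    -- `c`.
    _⊛_ : Row k → Vec (Row l) k → Row l
    c ⊛ X = tabulate λ j → sum λ i → lookup c i ⊗ lookup (lookup X i) j

    lookup-⊛ : ∀ (c : Row k) (X : Vec (Row l) k) j →
               lookup (c ⊛ X) j ≡ sum (λ i → lookup c i ⊗ lookup (lookup X i) j)
    lookup-⊛ c X j = lookup∘tabulate _ j

    0v-⊛ : ∀ (X : Vec (Row l) k) → 0v ⊛ X ≡ 0v
    0v-⊛ X = lookup-ext λ j → begin
      lookup (0v ⊛ X) j                               ≡⟨ lookup-⊛ 0v X j ⟩
      sum (λ i → lookup 0v i ⊗ lookup (lookup X i) j)
          ≡⟨ sum-zero _ (λ i → trans (cong (_⊗ lookup (lookup X i) j) (lookup-0v i)) (R.zeroˡ _)) ⟩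
      0#                                              ≡⟨ lookup-0v j ⟨
      lookup 0v j                                     ∎

    ⊛-assoc : ∀ (c : Row k) (X : Vec (Row l) k) (Y : Vec (Row m) l) →
              (c ⊛ X) ⊛ Y ≡ c ⊛ Vec.map (_⊛ Y) X
    ⊛-assoc c X Y = lookup-ext λ j → begin
      lookup ((c ⊛ X) ⊛ Y) j
        ≡⟨ lookup-⊛ (c ⊛ X) Y j ⟩
      sum (λ a → lookup (c ⊛ X) a ⊗ y a j)
        ≡⟨ sum-cong-≗ (λ a → trans (cong (_⊗ y a j) (lookup-⊛ c X a))
          (*-distribʳ-sum (y a j) (λ i → lookup c i ⊗ x i a))) ⟩
      sum (λ a → sum (λ i → lookup c i ⊗ x i a ⊗ y a j))
        ≡⟨ ∑-comm (λ a i → lookup c i ⊗ x i a ⊗ y a j) ⟩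
      sum (λ i → sum (λ a → lookup c i ⊗ x i a ⊗ y a j))
        ≡⟨ sum-cong-≗ (λ i → trans (sum-cong-≗ (λ a → R.*-assoc (lookup c i) (x i a) (y a j)))
             (sym (*-distribˡ-sum (lookup c i) (λ a → x i a ⊗ y a j)))) ⟩
      sum (λ i → lookup c i ⊗ sum (λ a → x i a ⊗ y a j))
        ≡⟨ sum-cong-≗ (λ i → cong (lookup c i ⊗_)
             (sym (trans (cong (λ v → lookup v j) (lookup-map i (_⊛ Y) X))
               (lookup-⊛ (lookup X i) Y j)))) ⟩
      sum (λ i → lookup c i ⊗ lookup (lookup (Vec.map (_⊛ Y) X) i) j)
        ≡⟨ lookup-⊛ c (Vec.map (_⊛ Y) X) j ⟨
      lookup (c ⊛ Vec.map (_⊛ Y) X) j ∎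
      where
      x = λ i a → lookup (lookup X i) a
      y = λ a j → lookup (lookup Y a) j

    -- A single operation covers difference (`a = neg 1#`) and scaling (`c = 0v`), so that one
    -- linearity lemma for `⊛` suffices.
    _⟨+_·⟩_ : Row l → Fin n → Row l → Row l
    c ⟨+ a ·⟩ d = Vec.zipWith (λ x y → x ⊕ a ⊗ y) c d

    ⊛-linear : ∀ (c : Row k) a d (X : Vec (Row l) k) → (c ⟨+ a ·⟩ d) ⊛ X ≡ (c ⊛ X) ⟨+ a ·⟩ (d ⊛ X)
    ⊛-linear c a d X = lookup-ext λ j → begin
      lookup ((c ⟨+ a ·⟩ d) ⊛ X) j
        ≡⟨ lookup-⊛ (c ⟨+ a ·⟩ d) X j ⟩
      sum (λ i → lookup (c ⟨+ a ·⟩ d) i ⊗ x i j)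
        ≡⟨ sum-cong-≗ (λ i → trans (cong (_⊗ x i j) (lookup-zipWith _ i c d))
             (trans (R.distribʳ (x i j) (lookup c i) _)
               (cong (lookup c i ⊗ x i j ⊕_) (R.*-assoc a _ _)))) ⟩
      sum (λ i → lookup c i ⊗ x i j ⊕ a ⊗ (lookup d i ⊗ x i j))
        ≡⟨ ∑-distrib-+ (λ i → lookup c i ⊗ x i j) (λ i → a ⊗ (lookup d i ⊗ x i j)) ⟩
      sum (λ i → lookup c i ⊗ x i j) ⊕ sum (λ i → a ⊗ (lookup d i ⊗ x i j))
        ≡⟨ cong₂ _⊕_ (sym (lookup-⊛ c X j)) (trans
          (sym (*-distribˡ-sum a (λ i → lookup d i ⊗ x i j))) (cong (a ⊗_) (sym (lookup-⊛ d X j)))) ⟩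
      lookup (c ⊛ X) j ⊕ a ⊗ lookup (d ⊛ X) j
        ≡⟨ lookup-zipWith _ j (c ⊛ X) (d ⊛ X) ⟨
      lookup ((c ⊛ X) ⟨+ a ·⟩ (d ⊛ X)) j ∎
      where
      x = λ i j → lookup (lookup X i) j

    ⊖-zero⇒≡ : ∀ (c d : Row l) → c ⟨+ neg 1# ·⟩ d ≡ 0v → c ≡ d
    ⊖-zero⇒≡ c d eq = lookup-ext λ i → x∙y⁻¹≈ε⇒x≈y (lookup c i) (lookup d i) (begin
      lookup c i ⊕ neg (lookup d i)       ≡⟨ cong (lookup c i ⊕_) (-1*x≈-x (lookup d i)) ⟨
      lookup c i ⊕ neg 1# ⊗ lookup d i    ≡⟨ lookup-zipWith _ i c d ⟨
      lookup (c ⟨+ neg 1# ·⟩ d) i         ≡⟨ cong (λ v → lookup v i) eq ⟩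
      lookup 0v i                         ≡⟨ lookup-0v i ⟩
      0#                                  ∎)

    ⊖-self : ∀ (c : Row l) → c ⟨+ neg 1# ·⟩ c ≡ 0v
    ⊖-self c = lookup-ext λ i → begin
      lookup (c ⟨+ neg 1# ·⟩ c) i         ≡⟨ lookup-zipWith _ i c c ⟩
      lookup c i ⊕ neg 1# ⊗ lookup c i    ≡⟨ cong (lookup c i ⊕_) (-1*x≈-x (lookup c i)) ⟩
      lookup c i ⊕ neg (lookup c i)       ≡⟨ R.-‿inverseʳ _ ⟩
      0#                                  ≡⟨ lookup-0v i ⟨
      lookup 0v i                         ∎

    -- Independent families, spans and invertibility

    Independent : Vec (Row l) k → Set
    Independent X = ∀ c → c ⊛ X ≡ 0v → c ≡ 0v

    independent-injective : ∀ (X : Vec (Row l) k) → Independent X → ∀ c d → c ⊛ X ≡ d ⊛ X → c ≡ d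
    independent-injective X indep c d eq = ⊖-zero⇒≡ c d (indep _ (begin
      (c ⟨+ neg 1# ·⟩ d) ⊛ X          ≡⟨ ⊛-linear c (neg 1#) d X ⟩
      (c ⊛ X) ⟨+ neg 1# ·⟩ (d ⊛ X)    ≡⟨ cong (λ v → v ⟨+ neg 1# ·⟩ (d ⊛ X)) eq ⟩
      (d ⊛ X) ⟨+ neg 1# ·⟩ (d ⊛ X)    ≡⟨ ⊖-self (d ⊛ X) ⟩
      0v                              ∎))

    rows : ∀ l → Enumeration (Row l)
    rows = vecs (fins n)

    module Rowsₑ (l : ℕ) = Enumeration (rows l)

    Spans : Vec (Row l) k → Row l → Set
    Spans X v = ∃ λ c → c ⊛ X ≡ v

    spans? : ∀ (X : Vec (Row l) k) v → Dec (Spans X v)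
    spans? {l} {k} X v = Rowsₑ.exists? k (λ c → Rowsₑ._≟_ l (c ⊛ X) v)

    independent? : ∀ (X : Vec (Row l) k) → Dec (Independent X)
    independent? {l} {k} X = Rowsₑ.forall? k (λ c → Rowsₑ._≟_ l (c ⊛ X) 0v →-dec Rowsₑ._≟_ k c 0v)

    -- Independence makes `c ↦ c ⊛ X` injective. A spanned row thus has exactly one coefficient row,
    -- and the indicator of the span is a sum of deltas over all `c`.
    sum-span : ∀ (X : Vec (Row l) k) → Independent X → ∀ (h : Row l → ℤ) →
               Rowsₑ.sum l (λ v → ind (spans? X v) * h v) ≡ Rowsₑ.sum k (λ c → h (c ⊛ X))
    sum-span {l} {k} X indep h = begin
      L.sum (λ v → ind (spans? X v) * h v)
        ≡⟨ sumOver-cong L.elems (λ v → cong (_* h v) (preimages v)) ⟩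
      L.sum (λ v → K.sum (λ c → ind (v L.≟ (c ⊛ X))) * h v)
        ≡⟨ sumOver-cong L.elems (λ v → sym (sumOver-*ʳ K.elems (h v) _)) ⟩
      L.sum (λ v → K.sum (λ c → ind (v L.≟ (c ⊛ X)) * h v))
        ≡⟨ sumOver-swap L.elems K.elems _ ⟩
      K.sum (λ c → L.sum (λ v → ind (v L.≟ (c ⊛ X)) * h v))
        ≡⟨ sumOver-cong K.elems (λ c → L.sum-pick (c ⊛ X) h) ⟩
      K.sum (λ c → h (c ⊛ X)) ∎
      where
      module L = Rowsₑ l
      module K = Rowsₑ k
      preimages : ∀ v → ind (spans? X v) ≡ K.sum (λ c → ind (v L.≟ (c ⊛ X)))
      preimages v = [ spanned , notSpanned ]′ (toSum (spans? X v))
        where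
        spanned : Spans X v → _
        spanned s@(c , cX≡v) = trans (ind-yes (spans? X v) s)
          (sym (K.sum-unique (λ d → v L.≟ (d ⊛ X)) c
                 (λ d eq → independent-injective X indep d c (trans (sym eq) (sym cX≡v)))
                   (sym cX≡v)))
        notSpanned : ¬ Spans X v → _
        notSpanned ¬s = trans (ind-no (spans? X v) ¬s)
          (sym (trans (sumOver-cong K.elems (λ c → ind-no (v L.≟ (c ⊛ X)) (λ eq → ¬s (c , sym eq))))
                      (sumOver-0 K.elems)))

    -- Pigeonhole by counting: `X` is square, so the injective map `c ↦ c ⊛ X` takes as many values
    -- as there are rows, and the number of rows it misses is zero.
    independent⇒spans : ∀ (X : Mat k n) → Independent X → ∀ v → Spans X v
    independent⇒spans {k} X indep v with spans? X v
    ... | yes s = s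
    ... | no ¬s = contradiction ¬s (K.ind-sum-zero (λ v → ¬? (spans? X v)) none v)
      where
      module K = Rowsₑ k
      none : K.sum (λ v → ind (¬? (spans? X v))) ≡ 0ℤ
      none = begin
        K.sum (λ v → ind (¬? (spans? X v)))
          ≡⟨ sumOver-cong K.elems (λ v → trans (ind-¬ (spans? X v))
            (cong (λ i → 1ℤ - i) (sym (ℤ.*-identityʳ (ind (spans? X v)))))) ⟩
        K.sum (λ v → 1ℤ - ind (spans? X v) * 1ℤ)
          ≡⟨ sumOver-- K.elems (λ _ → 1ℤ) (λ v → ind (spans? X v) * 1ℤ) ⟩
        K.size - K.sum (λ v → ind (spans? X v) * 1ℤ)
          ≡⟨ cong (λ i → K.size - i) (sum-span X indep (λ _ → 1ℤ)) ⟩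
        K.size - K.size
          ≡⟨ ℤ.+-inverseʳ K.size ⟩
        0ℤ ∎

    lookup-idMat : ∀ r i j → lookup (lookup (idMat r n) i) j ≡ (if does (i Fin.≟ j) then 1# else 0#)
    lookup-idMat r i j = trans (cong (λ v → lookup v j) (lookup∘tabulate _ i)) (lookup∘tabulate _ j)

    ⊛-idMat : ∀ (c : Row k) → c ⊛ idMat k n ≡ c
    ⊛-idMat {k} c = lookup-ext λ j → begin
      lookup (c ⊛ idMat k n) j
        ≡⟨ lookup-⊛ c (idMat k n) j ⟩
      sum (λ i → lookup c i ⊗ lookup (lookup (idMat k n) i) j)
        ≡⟨ sum-cong-≗ (λ i → cong (lookup c i ⊗_) (lookup-idMat k i j)) ⟩
      sum (λ i → lookup c i ⊗ (if does (i Fin.≟ j) then 1# else 0#))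
        ≡⟨ sum-δʳ (lookup c) j ⟩
      lookup c j ∎

    idMat-⊛ : ∀ (X : Vec (Row l) k) i → lookup (idMat k n) i ⊛ X ≡ lookup X i
    idMat-⊛ {k = k} X i = lookup-ext λ j → begin
      lookup (lookup (idMat k n) i ⊛ X) j
        ≡⟨ lookup-⊛ (lookup (idMat k n) i) X j ⟩
      sum (λ a → lookup (lookup (idMat k n) i) a ⊗ lookup (lookup X a) j)
        ≡⟨ sum-cong-≗ (λ a → cong (_⊗ lookup (lookup X a) j) (lookup-idMat k i a)) ⟩
      sum (λ a → (if does (i Fin.≟ a) then 1# else 0#) ⊗ lookup (lookup X a) j)
        ≡⟨ sum-δ (λ a → lookup (lookup X a) j) i ⟩
      lookup (lookup X i) j ∎

    ·≡map-⊛ : ∀ (X Y : Mat k n) → X · Y ≡ Vec.map (_⊛ Y) X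
    ·≡map-⊛ X Y = lookup-ext λ i → lookup-ext λ j → begin
      lookup (lookup (X · Y) i) j
        ≡⟨ trans (cong (λ v → lookup v j) (lookup∘tabulate _ i)) (lookup∘tabulate _ j) ⟩
      Vec.sum (tabulate λ a → toℕ (entry X i a) ℕ.* toℕ (entry Y a j)) mod n
        ≡⟨ sum-mod (λ a → toℕ (entry X i a) ℕ.* toℕ (entry Y a j)) ⟩
      sum (λ a → entry X i a ⊗ entry Y a j)
        ≡⟨ lookup-⊛ (lookup X i) Y j ⟨
      lookup (lookup X i ⊛ Y) j
        ≡⟨ cong (λ v → lookup v j) (lookup-map i (_⊛ Y) X) ⟨
      lookup (lookup (Vec.map (_⊛ Y) X) i) j ∎

    rightInverse⇒independent : ∀ (X Y : Mat k n) → X · Y ≡ idMat k n → Independent X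
    rightInverse⇒independent {k} X Y XY≡I c cX≡0 = begin
      c                    ≡⟨ ⊛-idMat c ⟨
      c ⊛ idMat k n        ≡⟨ cong (c ⊛_) (trans (sym XY≡I) (·≡map-⊛ X Y)) ⟩
      c ⊛ Vec.map (_⊛ Y) X ≡⟨ ⊛-assoc c X Y ⟨
      (c ⊛ X) ⊛ Y          ≡⟨ cong (_⊛ Y) cX≡0 ⟩
      0v ⊛ Y               ≡⟨ 0v-⊛ Y ⟩
      0v                   ∎

    IsGL⇒rightInverse : ∀ (X : Mat k n) → IsGL X → ∃ λ Y → X · Y ≡ idMat k n
    IsGL⇒rightInverse X gl with Y , XY≡I , _ ← Any.satisfied gl = Y , XY≡I

    IsGL⇒independent : ∀ (X : Mat k n) → IsGL X → Independent X
    IsGL⇒independent X gl with Y , XY≡I ← IsGL⇒rightInverse X gl = rightInverse⇒independent X Y XY≡I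

    -- The coefficient rows that yield the unit vectors form a left inverse `Y`. It is also a right
    -- inverse: `(X · Y) · X` and `X` agree, and independence allows `X` to be cancelled on the
    -- right.
    independent⇒IsGL : ∀ (X : Mat k n) → Independent X → IsGL X
    independent⇒IsGL {k} X indep =
      Any.map (λ { refl → XY≡I , YX≡I }) (Enumeration.complete (vecs (rows k) k) Y)
      where
      Y : Mat k n
      Y = tabulate λ i → proj₁ (independent⇒spans X indep (lookup (idMat k n) i))
      YX≡I : Y · X ≡ idMat k n
      YX≡I = trans (·≡map-⊛ Y X) (lookup-ext λ i → begin
        lookup (Vec.map (_⊛ X) Y) i ≡⟨ lookup-map i (_⊛ X) Y ⟩
        lookup Y i ⊛ X              ≡⟨ cong (_⊛ X) (lookup∘tabulate _ i) ⟩
        proj₁ (independent⇒spans X indep (lookup (idMat k n) i)) ⊛ X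
                                    ≡⟨ proj₂ (independent⇒spans X indep (lookup (idMat k n) i)) ⟩
        lookup (idMat k n) i        ∎)
      XY≡I : X · Y ≡ idMat k n
      XY≡I = trans (·≡map-⊛ X Y) (lookup-ext λ i → trans (lookup-map i (_⊛ Y) X)
        (independent-injective X indep _ _ (begin
        (lookup X i ⊛ Y) ⊛ X            ≡⟨ ⊛-assoc (lookup X i) Y X ⟩
        lookup X i ⊛ Vec.map (_⊛ X) Y   ≡⟨ cong (lookup X i ⊛_) (trans (sym (·≡map-⊛ Y X)) YX≡I) ⟩
        lookup X i ⊛ idMat k n          ≡⟨ ⊛-idMat (lookup X i) ⟩
        lookup X i                      ≡⟨ idMat-⊛ X i ⟨
        lookup (idMat k n) i ⊛ X        ∎)))

    trace : Mat k n → Fin n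
    trace X = sum (λ i → entry X i i)

    -- The share of the trace that comes from the rows of `X` once a further row has been put on top
    -- of them.
    superTrace : Vec (Row (suc k)) k → Fin n
    superTrace X = sum (λ i → lookup (lookup X i) (suc i))

    tr≡trace : ∀ (X : Mat k n) → tr X ≡ trace X
    tr≡trace X = trans (sum-mod (λ i → toℕ (entry X i i)))
        (sum-cong-≗ (λ i → mod-toℕ (entry X i i)))

    matrices : ∀ k → Enumeration (Mat k n)
    matrices k = vecs (rows k) k

    -- The trace is prescribed by a natural number `b`, so that counts for different moduli can be
    -- compared at the same `b`.
    traceCount : ∀ r → ℕ → ℤ
    traceCount r b = sumOver (allMats r n)
        (λ X → ind (independent? X) * ind (trace X Fin.≟ (b mod n)))

    Nβ≡traceCount : ∀ r β → ℤ.+ Nβ r n β ≡ traceCount r (toℕ β)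
    Nβ≡traceCount r β = trans (length-filter-ind _ (allMats r n))
      (sumOver-cong (allMats r n) λ X → trans (ind-× (isGL? X) (tr X Fin.≟ β))
        (cong₂ _*_ (ind-cong (isGL? X) (independent? X) (IsGL⇒independent X) (independent⇒IsGL X))
                   (cong₂ (λ s t → ind (s Fin.≟ t)) (tr≡trace X) (sym (mod-toℕ β)))))

  -- Counting over a prime field

  multiple-mod : ∀ k n .{{_ : NonZero n}} → (k ℕ.* n) mod n ≡ 0 mod n
  multiple-mod k n = mod-cong n {k ℕ.* n} {0}
      (trans (m*n%n≡0 k n) (sym (m<n⇒m%n≡m (ℕ.>-nonZero⁻¹ n))))

  coprime⇒inverse : ∀ {a} n .{{_ : NonZero n}} → Coprime a n →
                    ∃ λ u → Residues._⊗_ n u (a mod n) ≡ Residues.1# n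
  coprime⇒inverse {a} n coprime with coprime-Bézout coprime
  ... | Bézout.+- x y 1+yn≡xa = x mod n , (begin
      (x mod n) ⊗ (a mod n)    ≡⟨ mod-* x a ⟨
      (x ℕ.* a) mod n          ≡⟨ cong (_mod n) 1+yn≡xa ⟨
      (1 ℕ.+ y ℕ.* n) mod n    ≡⟨ mod-+ 1 (y ℕ.* n) ⟩
      1# ⊕ (y ℕ.* n) mod n     ≡⟨ cong (1# ⊕_) (multiple-mod y n) ⟩
      1# ⊕ 0#                  ≡⟨ R.+-identityʳ 1# ⟩
      1#                       ∎)
    where
    open Residues n
    module R = CommutativeRing residueRing
  ... | Bézout.-+ x y 1+xa≡yn = neg (x mod n) , (begin
      neg (x mod n) ⊗ (a mod n)     ≡⟨ -‿distribˡ-* (x mod n) (a mod n) ⟨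
      neg ((x mod n) ⊗ (a mod n))   ≡⟨ cong neg (mod-* x a) ⟨
      neg ((x ℕ.* a) mod n)         ≡⟨ inverseˡ-unique 1# ((x ℕ.* a) mod n) (begin
        1# ⊕ (x ℕ.* a) mod n          ≡⟨ mod-+ 1 (x ℕ.* a) ⟨
        (1 ℕ.+ x ℕ.* a) mod n         ≡⟨ cong (_mod n) 1+xa≡yn ⟩
        (y ℕ.* n) mod n               ≡⟨ multiple-mod y n ⟩
        0#                            ∎) ⟨
      1#                            ∎)
    where
    open Residues n
    module R = CommutativeRing residueRing
    open import Algebra.Properties.Ring R.ring using (-‿distribˡ-*)
    open import Algebra.Properties.Group R.+-group using (inverseˡ-unique)

  prime∤⇒coprime : ∀ {p a} → Prime p → p ∤ a → Coprime a p
  prime∤⇒coprime pp p∤a {d} (d∣a , d∣p) with prime⇒irreducible pp d∣p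
  ... | inj₁ d≡1  = d≡1
  ... | inj₂ refl = contradiction d∣a p∤a

  module PrimeField (p : ℕ) .{{_ : NonZero p}} (pp : Prime p) where

    open Residues p
    open Rows p
    open import Algebra.Properties.Ring R.ring using (-‿distribˡ-*)
    open import Algebra.Properties.Group R.+-group using (ε⁻¹≈ε; ⁻¹-injective)

    private
      variable
        k l : ℕ

    q : ℤ
    q = ℤ.+ p

    1#≢0# : 1# ≢ 0#
    1#≢0# eq = 1≢0 (trans (sym (m<n⇒m%n≡m (ℕ.nonTrivial⇒n>1 p {{prime⇒nonTrivial pp}})))
                          (trans (mod-injective p {1} {0} eq) (m<n⇒m%n≡m (ℕ.>-nonZero⁻¹ p))))
      where
      1≢0 : 1 ≢ 0
      1≢0 ()

    inverse : ∀ a → a ≢ 0# → ∃ λ u → u ⊗ a ≡ 1#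
    inverse a a≢0 = proj₁ found , trans (cong (proj₁ found ⊗_) (sym (mod-toℕ a))) (proj₂ found)
      where
      p∤a : p ∤ toℕ a
      p∤a p∣a = a≢0 (trans (sym (mod-toℕ a)) (mod-cong p {toℕ a} {0}
        (trans (n∣m⇒m%n≡0 (toℕ a) p p∣a) (sym (m<n⇒m%n≡m (ℕ.>-nonZero⁻¹ p))))))
      found = coprime⇒inverse p (prime∤⇒coprime pp p∤a)

    ∷-⊛ : ∀ c (cs : Row k) (v : Row l) X → (c ∷ cs) ⊛ (v ∷ X) ≡ (cs ⊛ X) ⟨+ c ·⟩ v
    ∷-⊛ c cs v X = lookup-ext λ j → begin
      lookup ((c ∷ cs) ⊛ (v ∷ X)) j                            ≡⟨ lookup-⊛ (c ∷ cs) (v ∷ X) j ⟩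
      c ⊗ lookup v j ⊕ sum (λ i → lookup cs i ⊗ lookup (lookup X i) j)
          ≡⟨ R.+-comm (c ⊗ lookup v j) (sum (λ i → lookup cs i ⊗ lookup (lookup X i) j)) ⟩
      sum (λ i → lookup cs i ⊗ lookup (lookup X i) j) ⊕ c ⊗ lookup v j
          ≡⟨ cong (_⊕ c ⊗ lookup v j) (lookup-⊛ cs X j) ⟨
      lookup (cs ⊛ X) j ⊕ c ⊗ lookup v j                       ≡⟨ lookup-zipWith _ j (cs ⊛ X) v ⟨
      lookup ((cs ⊛ X) ⟨+ c ·⟩ v) j                            ∎

    +0· : ∀ (w v : Row l) → w ⟨+ 0# ·⟩ v ≡ w
    +0· w v = lookup-ext λ j → begin
      lookup (w ⟨+ 0# ·⟩ v) j        ≡⟨ lookup-zipWith _ j w v ⟩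
      lookup w j ⊕ 0# ⊗ lookup v j   ≡⟨ cong (lookup w j ⊕_) (R.zeroˡ _) ⟩
      lookup w j ⊕ 0#                ≡⟨ R.+-identityʳ _ ⟩
      lookup w j                     ∎

    independent-tail : ∀ (v : Row l) (X : Vec (Row l) k) → Independent (v ∷ X) → Independent X
    independent-tail v X indep cs csX≡0 = ∷-injectiveʳ (indep (0# ∷ cs)
      (trans (∷-⊛ 0# cs v X) (trans (+0· (cs ⊛ X) v) csX≡0)))

    independent⇒∉span : ∀ (v : Row l) (X : Vec (Row l) k) → Independent (v ∷ X) → ¬ Spans X v
    -- The relation with coefficient -1 at `v` would force -1 to be zero.
    independent⇒∉span v X indep (cs , csX≡v) = 1#≢0# (⁻¹-injective (trans
      (∷-injectiveˡ (indep (neg 1# ∷ cs)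
        (trans (∷-⊛ (neg 1#) cs v X) (trans (cong (_⟨+ neg 1# ·⟩ v) csX≡v) (⊖-self v)))))
      (sym ε⁻¹≈ε)))

    ∉span⇒independent : ∀ (v : Row l) (X : Vec (Row l) k) → Independent X → ¬ Spans X v →
        Independent (v ∷ X)
    ∉span⇒independent v X indep v∉ (c ∷ cs) eq with c Fin.≟ 0#
    ... | yes refl = cong (0# ∷_) (indep cs
        (trans (sym (+0· (cs ⊛ X) v)) (trans (sym (∷-⊛ 0# cs v X)) eq)))
    -- Primality enters here: a nonzero coefficient of `v` can be divided out, which would place `v`
    -- in the span of `X`.
    ... | no c≢0 with u , uc≡1 ← inverse c c≢0 = contradiction (0v ⟨+ neg u ·⟩ cs , solved) v∉
      where
      solved : (0v ⟨+ neg u ·⟩ cs) ⊛ X ≡ v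
      solved = trans (⊛-linear 0v (neg u) cs X) (lookup-ext λ j → begin
        lookup ((0v ⊛ X) ⟨+ neg u ·⟩ (cs ⊛ X)) j
          ≡⟨ lookup-zipWith _ j (0v ⊛ X) (cs ⊛ X) ⟩
        lookup (0v ⊛ X) j ⊕ neg u ⊗ lookup (cs ⊛ X) j
          ≡⟨ cong₂ _⊕_ (trans (cong (λ w → lookup w j) (0v-⊛ X)) (lookup-0v j))
            (sym (-‿distribˡ-* u _)) ⟩
        0# ⊕ neg (u ⊗ lookup (cs ⊛ X) j)
          ≡⟨ R.+-identityˡ _ ⟩
        neg (u ⊗ lookup (cs ⊛ X) j)
          ≡⟨ inverseʳ-unique (u ⊗ lookup (cs ⊛ X) j) (lookup v j) (begin
               u ⊗ lookup (cs ⊛ X) j ⊕ lookup v j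
                 ≡⟨ cong (u ⊗ lookup (cs ⊛ X) j ⊕_) (trans (sym (R.*-identityˡ _))
                   (trans (cong (_⊗ lookup v j) (sym uc≡1)) (R.*-assoc u c _))) ⟩
               u ⊗ lookup (cs ⊛ X) j ⊕ u ⊗ (c ⊗ lookup v j)
                 ≡⟨ R.distribˡ u _ _ ⟨
               u ⊗ (lookup (cs ⊛ X) j ⊕ c ⊗ lookup v j)
                 ≡⟨ cong (u ⊗_) (trans (sym (lookup-zipWith _ j (cs ⊛ X) v))
                   (cong (λ w → lookup w j) (trans (sym (∷-⊛ c cs v X)) eq))) ⟩
               u ⊗ lookup 0v j
                 ≡⟨ trans (cong (u ⊗_) (lookup-0v j)) (R.zeroʳ u) ⟩
               0# ∎) ⟨
        lookup v j ∎)

    ind-independent-∷ : ∀ (v : Row l) (X : Vec (Row l) k) →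
      ind (independent? (v ∷ X)) ≡ ind (independent? X) * (1ℤ - ind (spans? X v))
    ind-independent-∷ v X = begin
      ind (independent? (v ∷ X))
        ≡⟨ ind-cong (independent? (v ∷ X)) (independent? X ×-dec ¬? (spans? X v))
             (λ i → independent-tail v X i , independent⇒∉span v X i)
             (λ (i , v∉) → ∉span⇒independent v X i v∉) ⟩
      ind (independent? X ×-dec ¬? (spans? X v))
        ≡⟨ ind-× (independent? X) (¬? (spans? X v)) ⟩
      ind (independent? X) * ind (¬? (spans? X v))
        ≡⟨ cong (ind (independent? X) *_) (ind-¬ (spans? X v)) ⟩
      ind (independent? X) * (1ℤ - ind (spans? X v)) ∎

    module Families (k l : ℕ) = Enumeration (vecs (rows l) k)

    -- The admissible top rows are all rows minus those in the span, and the latter are parametrised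
    -- by their coefficients through `sum-span`. The weight `h` is left open: a constant counts
    -- independent families, an indicator of the trace gives the recursion for `traceCount`.
    sum-independent-∷ : ∀ (h : Row l → Vec (Row l) k → ℤ) →
      Families.sum (suc k) l (λ Z → ind (independent? Z) * h (Vec.head Z) (Vec.tail Z))
      ≡ Families.sum k l (λ X → ind (independent? X)
                               * (Rowsₑ.sum l (λ v → h v X) - Rowsₑ.sum k (λ c → h (c ⊛ X) X)))
    sum-independent-∷ {l} {k} h = begin
      Families.sum (suc k) l (λ Z → ind (independent? Z) * h (Vec.head Z) (Vec.tail Z))
        ≡⟨ sumOver-allVecs k L.elems (λ Z → ind (independent? Z) * h (Vec.head Z) (Vec.tail Z)) ⟩
      L.sum (λ v → F.sum (λ X → ind (independent? (v ∷ X)) * h v X))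
        ≡⟨ sumOver-swap L.elems F.elems (λ v X → ind (independent? (v ∷ X)) * h v X) ⟩
      F.sum (λ X → L.sum (λ v → ind (independent? (v ∷ X)) * h v X))
        ≡⟨ sumOver-cong F.elems (λ X → trans (sumOver-cong L.elems (λ v → expand v X))
             (sumOver-*ˡ L.elems (ind (independent? X)) (λ v → h v X - ind (spans? X v) * h v X))) ⟩
      F.sum (λ X → ind (independent? X) * L.sum (λ v → h v X - ind (spans? X v) * h v X))
        ≡⟨ sumOver-cong F.elems (λ X → ind-*-cong (independent? X) (λ indep → begin
             L.sum (λ v → h v X - ind (spans? X v) * h v X)
               ≡⟨ sumOver-- L.elems (λ v → h v X) (λ v → ind (spans? X v) * h v X) ⟩
             L.sum (λ v → h v X) - L.sum (λ v → ind (spans? X v) * h v X)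
               ≡⟨ cong (λ i → L.sum (λ v → h v X) - i) (sum-span X indep (λ v → h v X)) ⟩
             L.sum (λ v → h v X) - Rowsₑ.sum k (λ c → h (c ⊛ X) X) ∎)) ⟩
      F.sum (λ X → ind (independent? X) * (L.sum (λ v → h v X) - Rowsₑ.sum k (λ c → h (c ⊛ X) X))) ∎
      where
      module L = Rowsₑ l
      module F = Families k l
      expand : ∀ v X → ind (independent? (v ∷ X)) * h v X
                       ≡ ind (independent? X) * (h v X - ind (spans? X v) * h v X)
      expand v X = trans (cong (_* h v X) (ind-independent-∷ v X))
        (solve 3 (λ i s h → i :* (con 1ℤ :- s) :* h := i :* (h :- s :* h)) refl
          (ind (independent? X)) (ind (spans? X v)) (h v X))
        where open ℤ-Solver

    -- The number of independent families

    size-rows : ∀ l → Rowsₑ.size l ≡ q ℤ.^ l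
    size-rows l = trans (size-vecs (fins p) l) (cong (ℤ._^ l) (size-fins p))

    independentCount : ℕ → ℕ → ℤ
    independentCount k l = Families.sum k l (λ X → ind (independent? X))

    independentCount-zero : ∀ l → independentCount 0 l ≡ 1ℤ
    independentCount-zero l = trans (ℤ.+-identityʳ _)
        (ind-yes (independent? {l} []) (λ { [] _ → refl }))

    -- The span of `k` independent rows has `q ℤ.^ k` elements, and a further row has to avoid it.
    independentCount-suc : ∀ k l → independentCount (suc k) l ≡ independentCount k l *
        (q ℤ.^ l - q ℤ.^ k)
    independentCount-suc k l = begin
      independentCount (suc k) l
        ≡⟨ sumOver-cong (allVecs (suc k) L.elems) (λ Z → sym (ℤ.*-identityʳ (ind (independent? Z)))) ⟩
      Families.sum (suc k) l (λ Z → ind (independent? Z) * 1ℤ)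
        ≡⟨ sum-independent-∷ {l} {k} (λ _ _ → 1ℤ) ⟩
      Families.sum k l (λ X → ind (independent? X) * (L.size - Rowsₑ.size k))
        ≡⟨ sumOver-*ʳ (allVecs k L.elems) (L.size - Rowsₑ.size k) (λ X → ind (independent? X)) ⟩
      independentCount k l * (L.size - Rowsₑ.size k)
        ≡⟨ cong₂ (λ s t → independentCount k l * (s - t)) (size-rows l) (size-rows k) ⟩
      independentCount k l * (q ℤ.^ l - q ℤ.^ k) ∎
      where module L = Rowsₑ l

    -- Values of an affine form on all rows

    dot : Row k → Row k → Fin p
    dot c u = sum (λ i → lookup c i ⊗ lookup u i)

    -- With `u` the first column of `X` and `s` its `superTrace`, the `c` counted here are those for
    -- which putting `c ⊛ X` on top of `X` produces trace `β`.
    hyperplaneCount : Row k → Fin p → Fin p → ℤ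
    hyperplaneCount {k} u s β = Rowsₑ.sum k (λ c → ind (dot c u ⊕ s Fin.≟ β))

    dot-0v : ∀ (c : Row k) → dot c 0v ≡ 0#
    dot-0v c = sum-zero _ (λ i → trans (cong (lookup c i ⊗_) (lookup-0v i)) (R.zeroʳ (lookup c i)))

    hyperplaneCount-zero : ∀ k s β → q * hyperplaneCount {k} 0v s β ≡ q ℤ.^ suc k * ind (s Fin.≟ β)
    hyperplaneCount-zero k s β = begin
      q * K.sum (λ c → ind (dot c 0v ⊕ s Fin.≟ β))
        ≡⟨ cong (q *_) (sumOver-cong K.elems (λ c → cong (λ t → ind (t Fin.≟ β))
             (trans (cong (_⊕ s) (dot-0v c)) (R.+-identityˡ s)))) ⟩
      q * K.sum (λ c → ind (s Fin.≟ β))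
        ≡⟨ cong (q *_) (trans (K.sum-const (ind (s Fin.≟ β)))
          (cong (_* ind (s Fin.≟ β)) (size-rows k))) ⟩
      q * (q ℤ.^ k * ind (s Fin.≟ β))
        ≡⟨ ℤ.*-assoc q (q ℤ.^ k) _ ⟨
      q ℤ.^ suc k * ind (s Fin.≟ β) ∎
      where module K = Rowsₑ k

    -- The inverse `u` of the slope is an argument, which lets the same lemma serve slope `1#` and
    -- an arbitrary nonzero slope.
    affine-unique : ∀ {a u} → u ⊗ a ≡ 1# → ∀ d s β →
                    sumOver (Enumeration.elems (fins p)) (λ x → ind (x ⊗ a ⊕ d ⊕ s Fin.≟ β)) ≡ 1ℤ
    affine-unique {a} {u} ua≡1 d s β = Enumeration.sum-unique (fins p) (λ x → x ⊗ a ⊕ d ⊕ s Fin.≟ β)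
      ((β ⊕ neg (d ⊕ s)) ⊗ u) unique (begin
        (β ⊕ neg (d ⊕ s)) ⊗ u ⊗ a ⊕ d ⊕ s      ≡⟨ R.+-assoc _ d s ⟩
        (β ⊕ neg (d ⊕ s)) ⊗ u ⊗ a ⊕ (d ⊕ s)
          ≡⟨ cong (_⊕ (d ⊕ s)) (trans (R.*-assoc (β ⊕ neg (d ⊕ s)) u a)
            (trans (cong ((β ⊕ neg (d ⊕ s)) ⊗_) ua≡1) (R.*-identityʳ (β ⊕ neg (d ⊕ s))))) ⟩
        β ⊕ neg (d ⊕ s) ⊕ (d ⊕ s)              ≡⟨ R.+-assoc β _ _ ⟩
        β ⊕ (neg (d ⊕ s) ⊕ (d ⊕ s))            ≡⟨ cong (β ⊕_) (R.-‿inverseˡ (d ⊕ s)) ⟩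
        β ⊕ 0#                                 ≡⟨ R.+-identityʳ β ⟩
        β                                      ∎)
      where
      unique : ∀ x → x ⊗ a ⊕ d ⊕ s ≡ β → x ≡ (β ⊕ neg (d ⊕ s)) ⊗ u
      unique x refl = sym (begin
        (x ⊗ a ⊕ d ⊕ s ⊕ neg (d ⊕ s)) ⊗ u
          ≡⟨ cong (λ t → (t ⊕ neg (d ⊕ s)) ⊗ u) (R.+-assoc _ d s) ⟩
        (x ⊗ a ⊕ (d ⊕ s) ⊕ neg (d ⊕ s)) ⊗ u    ≡⟨ cong (_⊗ u) (R.+-assoc _ _ _) ⟩
        (x ⊗ a ⊕ ((d ⊕ s) ⊕ neg (d ⊕ s))) ⊗ u
          ≡⟨ cong (λ t → (x ⊗ a ⊕ t) ⊗ u) (R.-‿inverseʳ (d ⊕ s)) ⟩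
        (x ⊗ a ⊕ 0#) ⊗ u                       ≡⟨ cong (_⊗ u) (R.+-identityʳ _) ⟩
        x ⊗ a ⊗ u                              ≡⟨ R.*-assoc x a u ⟩
        x ⊗ (a ⊗ u)                            ≡⟨ cong (x ⊗_) (trans (R.*-comm a u) ua≡1) ⟩
        x ⊗ 1#                                 ≡⟨ R.*-identityʳ x ⟩
        x                                      ∎)

    -- A nonzero linear form is equidistributed. The coordinate belonging to the first nonzero entry
    -- of `u` is solved for; each zero entry before it contributes a free coordinate, hence a factor
    -- `q`.
    hyperplaneCount-nonzero : ∀ (u : Row k) s β → u ≢ 0v → q * hyperplaneCount u s β ≡ q ℤ.^ k
    hyperplaneCount-nonzero []      s β u≢0 = contradiction refl u≢0
    hyperplaneCount-nonzero {suc k} (a ∷ u) s β u≢0 with a Fin.≟ 0#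
    ... | no a≢0 = cong (q *_) (begin
      hyperplaneCount (a ∷ u) s β
        ≡⟨ sumOver-allVecs k P.elems (λ c → ind (dot c (a ∷ u) ⊕ s Fin.≟ β)) ⟩
      P.sum (λ x → K.sum (λ c → ind (x ⊗ a ⊕ dot c u ⊕ s Fin.≟ β)))
        ≡⟨ sumOver-swap P.elems K.elems (λ x c → ind (x ⊗ a ⊕ dot c u ⊕ s Fin.≟ β)) ⟩
      K.sum (λ c → P.sum (λ x → ind (x ⊗ a ⊕ dot c u ⊕ s Fin.≟ β)))
        ≡⟨ sumOver-cong K.elems (λ c → affine-unique {a} {proj₁ (inverse a a≢0)}
          (proj₂ (inverse a a≢0)) (dot c u) s β) ⟩
      K.size
        ≡⟨ size-rows k ⟩
      q ℤ.^ k ∎)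
      where
      module K = Rowsₑ k
      module P = Enumeration (fins p)
    ... | yes refl = cong (q *_) (begin
      hyperplaneCount (0# ∷ u) s β
        ≡⟨ sumOver-allVecs k P.elems (λ c → ind (dot c (0# ∷ u) ⊕ s Fin.≟ β)) ⟩
      P.sum (λ x → K.sum (λ c → ind (x ⊗ 0# ⊕ dot c u ⊕ s Fin.≟ β)))
        ≡⟨ sumOver-cong P.elems (λ x → sumOver-cong K.elems λ c → cong (λ t → ind (t ⊕ s Fin.≟ β))
             (trans (cong (_⊕ dot c u) (R.zeroʳ x)) (R.+-identityˡ _))) ⟩
      P.sum (λ x → hyperplaneCount u s β)
        ≡⟨ trans (P.sum-const _) (cong (_* hyperplaneCount u s β) (size-fins p)) ⟩
      q * hyperplaneCount u s β
        ≡⟨ hyperplaneCount-nonzero u s β (λ u≡0 → u≢0 (cong (0# ∷_) u≡0)) ⟩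
      q ℤ.^ k ∎)
      where
      module K = Rowsₑ k
      module P = Enumeration (fins p)

    -- The two cases are joined as the equidistributed value plus a correction supported at
    -- `u = 0v`, so that the sum over all families separates into the corresponding two parts.
    hyperplaneCount-formula : ∀ (u : Row k) s β →
      q * hyperplaneCount u s β
      ≡ q ℤ.^ k + ind (Rowsₑ._≟_ k u 0v) * (q ℤ.^ suc k * ind (s Fin.≟ β) - q ℤ.^ k)
    hyperplaneCount-formula {k} u s β with Rowsₑ._≟_ k u 0v
    ... | yes refl = trans (hyperplaneCount-zero k s β)
      (solve 2 (λ x y → x := y :+ con 1ℤ :* (x :- y)) refl (q ℤ.^ suc k * ind (s Fin.≟ β))
        (q ℤ.^ k))
      where open ℤ-Solver
    ... | no u≢0 = trans (hyperplaneCount-nonzero u s β u≢0) (sym (ℤ.+-identityʳ _))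

    -- Families whose first column vanishes

    firstColumn : Vec (Row (suc l)) k → Row k
    firstColumn = Vec.map Vec.head

    sum-zeroFirstColumn : ∀ k (g : Vec (Row (suc l)) k → ℤ) →
      Families.sum k (suc l) (λ X → ind (Rowsₑ._≟_ k (firstColumn X) 0v) * g X)
      ≡ Families.sum k l (λ Y → g (Vec.map (0# ∷_) Y))
    sum-zeroFirstColumn {l} zero    g = cong (_+ 0ℤ) (ℤ.*-identityˡ (g []))
    sum-zeroFirstColumn {l} (suc k) g = begin
      Families.sum (suc k) (suc l) (λ X → ind (Rowsₑ._≟_ (suc k) (firstColumn X) 0v) * g X)
        ≡⟨ sumOver-allVecs k (allVecs (suc l) P.elems)
          (λ X → ind (Rowsₑ._≟_ (suc k) (firstColumn X) 0v) * g X) ⟩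
      Rowsₑ.sum (suc l) (λ v → F.sum (λ X → ind (Rowsₑ._≟_ (suc k) (Vec.head v ∷ firstColumn X) 0v)
          * g (v ∷ X)))
        ≡⟨ sumOver-allVecs l P.elems (λ v → F.sum
          (λ X → ind (Rowsₑ._≟_ (suc k) (Vec.head v ∷ firstColumn X) 0v) * g (v ∷ X))) ⟩
      P.sum (λ x → L.sum (λ w → F.sum (λ X → ind
          ((x Fin.≟ 0#) ×-dec (Rowsₑ._≟_ k (firstColumn X) 0v)) * g ((x ∷ w) ∷ X))))
        ≡⟨ sumOver-cong P.elems (λ x → trans
             (sumOver-cong L.elems (λ w → trans
               (sumOver-cong F.elems (λ X → trans (cong (_* g ((x ∷ w) ∷ X))
                 (ind-× (x Fin.≟ 0#) (Rowsₑ._≟_ k (firstColumn X) 0v)))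
                 (ℤ.*-assoc (ind (x Fin.≟ 0#)) _ _)))
               (sumOver-*ˡ F.elems (ind (x Fin.≟ 0#))
                 (λ X → ind (Rowsₑ._≟_ k (firstColumn X) 0v) * g ((x ∷ w) ∷ X)))))
             (sumOver-*ˡ L.elems (ind (x Fin.≟ 0#))
               (λ w → F.sum (λ X → ind (Rowsₑ._≟_ k (firstColumn X) 0v) * g ((x ∷ w) ∷ X))))) ⟩
      P.sum (λ x → ind (x Fin.≟ 0#) * L.sum
          (λ w → F.sum (λ X → ind (Rowsₑ._≟_ k (firstColumn X) 0v) * g ((x ∷ w) ∷ X))))
        ≡⟨ P.sum-pick 0# (λ x → L.sum (λ w → F.sum
          (λ X → ind (Rowsₑ._≟_ k (firstColumn X) 0v) * g ((x ∷ w) ∷ X)))) ⟩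
      L.sum (λ w → F.sum (λ X → ind (Rowsₑ._≟_ k (firstColumn X) 0v) * g ((0# ∷ w) ∷ X)))
        ≡⟨ sumOver-cong L.elems (λ w → sum-zeroFirstColumn k (λ X → g ((0# ∷ w) ∷ X))) ⟩
      L.sum (λ w → Families.sum k l (λ Y → g ((0# ∷ w) ∷ Vec.map (0# ∷_) Y)))
        ≡⟨ sumOver-allVecs k L.elems (λ Y → g (Vec.map (0# ∷_) Y)) ⟨
      Families.sum (suc k) l (λ Y → g (Vec.map (0# ∷_) Y)) ∎
      where
      module P = Enumeration (fins p)
      module L = Rowsₑ l
      module F = Families k (suc l)

    ⊛-0∷ : ∀ (c : Row k) (Y : Vec (Row l) k) → c ⊛ Vec.map (0# ∷_) Y ≡ 0# ∷ (c ⊛ Y)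
    ⊛-0∷ c Y = lookup-ext λ where
      zero    → trans (lookup-⊛ c (Vec.map (0# ∷_) Y) zero) (sum-zero _ (λ i →
                  trans (cong (λ v → lookup c i ⊗ lookup v zero) (lookup-map i (0# ∷_) Y))
                      (R.zeroʳ (lookup c i))))
      (suc j) → trans (lookup-⊛ c (Vec.map (0# ∷_) Y) (suc j)) (trans
                  (sum-cong-≗ (λ i → cong (λ v → lookup c i ⊗ lookup v (suc j))
                    (lookup-map i (0# ∷_) Y)))
                  (sym (lookup-⊛ c Y j)))

    ind-independent-0∷ : ∀ (Y : Vec (Row l) k) →
                         ind (independent? (Vec.map (0# ∷_) Y)) ≡ ind (independent? Y)
    ind-independent-0∷ Y = ind-cong (independent? (Vec.map (0# ∷_) Y)) (independent? Y)
      (λ indep c cY≡0 → indep c (trans (⊛-0∷ c Y) (cong (0# ∷_) cY≡0)))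
      (λ indep c eq → indep c (∷-injectiveʳ (trans (sym (⊛-0∷ c Y)) eq)))

    -- Deleting the zero column undoes the column shift in `superTrace`. The correction term
    -- therefore counts square matrices of the smaller size by their trace, and the recursion
    -- closes.
    superTrace-0∷ : ∀ (Y : Mat k p) → superTrace (Vec.map (0# ∷_) Y) ≡ trace Y
    superTrace-0∷ Y = sum-cong-≗ (λ i → cong (λ v → lookup v (suc i)) (lookup-map i (0# ∷_) Y))

    -- For an independent `X`, `q` times the number of admissible top rows is
    -- `Q′ - Q - Z X * (Q′ * T X - Q)`. The part `Q′ - Q` sums to the number of invertible matrices
    -- of size `suc r`; the rest lives on families with zero first column, where `T X` leads to
    -- `traceCount r b` and the constant to `independentCount r r`.
    traceCount-suc : ∀ r b →
      q * traceCount (suc r) b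
      ≡ independentCount (suc r) (suc r) + q ℤ.^ r * independentCount r r - q ℤ.^ suc r * traceCount
          r b
    traceCount-suc r b = begin
      q * traceCount (suc r) b
        -- Once the corner entry is exposed, `trace` computes to that entry plus the `superTrace` of
        -- the lower rows.
        ≡⟨ cong (q *_) (sumOver-cong (allMats (suc r) p) (λ { ((x ∷ w) ∷ X) → refl })) ⟩
      q * Families.sum (suc r) (suc r) (λ Z → ind (independent? Z) * h (Vec.head Z) (Vec.tail Z))
        ≡⟨ cong (q *_) (sum-independent-∷ h) ⟩
      q * F.sum (λ X → I X * (Rowsₑ.sum (suc r) (λ v → h v X) - Rowsₑ.sum r (λ c → h (c ⊛ X) X)))
        ≡⟨ sumOver-*ˡ F.elems q (λ X → I X *
          (Rowsₑ.sum (suc r) (λ v → h v X) - Rowsₑ.sum r (λ c → h (c ⊛ X) X))) ⟨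
      F.sum (λ X → q * (I X * (Rowsₑ.sum (suc r) (λ v → h v X) - Rowsₑ.sum r (λ c → h (c ⊛ X) X))))
        ≡⟨ sumOver-cong F.elems perFamily ⟩
      F.sum (λ X → I X * (Q′ - Q) - (Q′ * (Z X * (I X * T X)) - Q * (Z X * I X)))
        ≡⟨ sumOver-- F.elems (λ X → I X * (Q′ - Q))
          (λ X → Q′ * (Z X * (I X * T X)) - Q * (Z X * I X)) ⟩
      F.sum (λ X → I X * (Q′ - Q)) - F.sum (λ X → Q′ * (Z X * (I X * T X)) - Q * (Z X * I X))
        ≡⟨ cong₂ _-_ (trans (sumOver-*ʳ F.elems (Q′ - Q) I) (sym (independentCount-suc r (suc r))))
             (sumOver-- F.elems (λ X → Q′ * (Z X * (I X * T X))) (λ X → Q * (Z X * I X))) ⟩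
      G′ - (F.sum (λ X → Q′ * (Z X * (I X * T X))) - F.sum (λ X → Q * (Z X * I X)))
        ≡⟨ cong₂ (λ s t → G′ - (s - t))
             (trans (sumOver-*ˡ F.elems Q′ (λ X → Z X * (I X * T X))) (cong (Q′ *_)
               (trans (sum-zeroFirstColumn r (λ X → I X * T X))
                      (sumOver-cong (allMats r p) λ Y → cong₂ _*_ (ind-independent-0∷ Y)
                        (cong (λ t → ind (t Fin.≟ β)) (superTrace-0∷ Y))))))
             (trans (sumOver-*ˡ F.elems Q (λ X → Z X * I X)) (cong (Q *_)
               (trans (sum-zeroFirstColumn r I) (sumOver-cong (allMats r p) ind-independent-0∷)))) ⟩
      G′ - (Q′ * traceCount r b - Q * independentCount r r)
        ≡⟨ solve 3 (λ x y z → x :- (y :- z) := x :+ z :- y) refl G′ (Q′ * traceCount r b)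
          (Q * independentCount r r) ⟩
      G′ + Q * independentCount r r - Q′ * traceCount r b ∎
      where
      open ℤ-Solver
      module F = Families r (suc r)
      β = b mod p
      Q = q ℤ.^ r
      Q′ = q ℤ.^ suc r
      G′ = independentCount (suc r) (suc r)
      I Z T : Vec (Row (suc r)) r → ℤ
      I X = ind (independent? X)
      Z X = ind (Rowsₑ._≟_ r (firstColumn X) 0v)
      T X = ind (superTrace X Fin.≟ β)
      h : Row (suc r) → Vec (Row (suc r)) r → ℤ
      h v X = ind (lookup v zero ⊕ superTrace X Fin.≟ β)
      allRows : ∀ X → Rowsₑ.sum (suc r) (λ v → h v X) ≡ Q
      allRows X = begin
        Rowsₑ.sum (suc r) (λ v → h v X)
          ≡⟨ sumOver-allVecs r (Enumeration.elems (fins p)) (λ v → h v X) ⟩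
        Enumeration.sum (fins p) (λ x → Rowsₑ.sum r (λ w → ind (x ⊕ superTrace X Fin.≟ β)))
          ≡⟨ sumOver-swap (Enumeration.elems (fins p)) (Rowsₑ.elems r)
            (λ x w → ind (x ⊕ superTrace X Fin.≟ β)) ⟩
        Rowsₑ.sum r (λ w → Enumeration.sum (fins p) (λ x → ind (x ⊕ superTrace X Fin.≟ β)))
          ≡⟨ sumOver-cong (Rowsₑ.elems r) (λ _ → trans
               (sumOver-cong (Enumeration.elems (fins p))
                 (λ x → cong (λ t → ind (t ⊕ superTrace X Fin.≟ β))
                 (sym (trans (R.+-identityʳ _) (R.*-identityʳ x)))))
               (affine-unique {1#} {1#} (R.*-identityˡ 1#) 0# (superTrace X) β)) ⟩
        Rowsₑ.size r
          ≡⟨ size-rows r ⟩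
        Q ∎
      spannedRows : ∀ X → Rowsₑ.sum r (λ c → h (c ⊛ X) X) ≡ hyperplaneCount (firstColumn X)
          (superTrace X) β
      spannedRows X = sumOver-cong (Rowsₑ.elems r)
          (λ c → cong (λ t → ind (t ⊕ superTrace X Fin.≟ β))
        (trans (lookup-⊛ c X zero) (sum-cong-≗ (λ i → cong (lookup c i ⊗_)
          (sym (trans (lookup-map i Vec.head X) (head-lookup (lookup X i))))))))
        where
        head-lookup : ∀ (v : Row (suc r)) → Vec.head v ≡ lookup v zero
        head-lookup (x ∷ v) = refl
      perFamily : ∀ X → q * (I X * (Rowsₑ.sum (suc r) (λ v → h v X) - Rowsₑ.sum r
          (λ c → h (c ⊛ X) X)))
                        ≡ I X * (Q′ - Q) - (Q′ * (Z X * (I X * T X)) - Q * (Z X * I X))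
      perFamily X = begin
        q * (I X * (Rowsₑ.sum (suc r) (λ v → h v X) - Rowsₑ.sum r (λ c → h (c ⊛ X) X)))
          ≡⟨ cong₂ (λ s t → q * (I X * (s - t))) (allRows X) (spannedRows X) ⟩
        q * (I X * (Q - H))
          ≡⟨ solve 4 (λ q i a b → q :* (i :* (a :- b)) := i :* (q :* a :- q :* b)) refl q (I X) Q H ⟩
        I X * (Q′ - q * H)
          ≡⟨ cong (λ t → I X * (Q′ - t)) (hyperplaneCount-formula (firstColumn X) (superTrace X) β) ⟩
        I X * (Q′ - (Q + Z X * (Q′ * T X - Q)))
          ≡⟨ solve 5 (λ i a b z t → i :* (a :- (b :+ z :* (a :* t :- b)))
                       := i :* (a :- b) :- (a :* (z :* (i :* t)) :- b :* (z :* i))) refl (I X) Q′ Q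
                           (Z X) (T X) ⟩
        I X * (Q′ - Q) - (Q′ * (Z X * (I X * T X)) - Q * (Z X * I X)) ∎
        where H = hyperplaneCount (firstColumn X) (superTrace X) β

    -- This is r(r-1)/2, in recursive form because each step of the trace recursion contributes one
    -- factor `q ℤ.^ r`.
    triangle : ℕ → ℕ
    triangle zero    = 0
    triangle (suc r) = triangle r ℕ.+ r

    -- In the recursion the terms cancel so that the deviation `q * traceCount r b -
    -- independentCount r r` is multiplied by `- (q ℤ.^ r)` at each step. It starts from the empty
    -- matrix, which is invertible of trace zero, with the value `q * δ - 1ℤ`.
    traceCount-prime : ∀ r b →
      q * traceCount r b
      ≡ independentCount r r + (- 1ℤ) ℤ.^ r * q ℤ.^ triangle r * (q * ind (0# Fin.≟ (b mod p)) - 1ℤ)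
    traceCount-prime zero b = begin
      q * (ind (independent? {0} []) * δ + 0ℤ)
        ≡⟨ cong (λ i → q * (i * δ + 0ℤ)) (ind-yes (independent? {0} []) (λ { [] _ → refl })) ⟩
      q * (1ℤ * δ + 0ℤ)
        ≡⟨ solve 2 (λ q δ → q :* (con 1ℤ :* δ :+ con 0ℤ) := con 1ℤ :+ con 1ℤ :* con 1ℤ :*
          (q :* δ :- con 1ℤ)) refl q δ ⟩
      1ℤ + 1ℤ * 1ℤ * (q * δ - 1ℤ)
        ≡⟨ cong (_+ 1ℤ * 1ℤ * (q * δ - 1ℤ)) (independentCount-zero 0) ⟨
      independentCount 0 0 + 1ℤ * 1ℤ * (q * δ - 1ℤ) ∎
      where
      open ℤ-Solver
      δ = ind (0# Fin.≟ (b mod p))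
    traceCount-prime (suc r) b = begin
      q * traceCount (suc r) b
        ≡⟨ traceCount-suc r b ⟩
      G′ + Q * G - q * Q * N
        ≡⟨ solve 5 (λ g′ a g q n → g′ :+ a :* g :- q :* a :* n := g′ :+ a :* g :- a :* (q :* n))
          refl G′ Q G q N ⟩
      G′ + Q * G - Q * (q * N)
        ≡⟨ cong (λ t → G′ + Q * G - Q * t) (traceCount-prime r b) ⟩
      G′ + Q * G - Q * (G + S * t * D)
        ≡⟨ solve 6 (λ g′ a g s t d → g′ :+ a :* g :- a :* (g :+ s :* t :* d)
                      := g′ :+ con (- 1ℤ) :* s :* (t :* a) :* d) refl G′ Q G S t D ⟩
      G′ + (- 1ℤ) * S * (t * Q) * D
        ≡⟨ cong (λ u → G′ + (- 1ℤ) * S * u * D) (ℤ.^-distribˡ-+-* q (triangle r) r) ⟨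
      G′ + (- 1ℤ) ℤ.^ suc r * q ℤ.^ triangle (suc r) * D ∎
      where
      open ℤ-Solver
      G′ = independentCount (suc r) (suc r)
      G = independentCount r r
      Q = q ℤ.^ r
      N = traceCount r b
      S = (- 1ℤ) ℤ.^ r
      t = q ℤ.^ triangle r
      D = q * ind (0# Fin.≟ (b mod p)) - 1ℤ

    -- In the product of all `q ℤ.^ suc r - q ℤ.^ i` for i from 0 to r, the factor at i = 0 is split
    -- off and one `q` is taken out of each of the other r factors. The induction runs over
    -- rectangles because `independentCount-suc` adds a row while the row length stays fixed.
    independentCount-square-suc : ∀ r →
      independentCount (suc r) (suc r) ≡ (q ℤ.^ suc r - 1ℤ) * q ℤ.^ r * independentCount r r
    independentCount-square-suc r = shift r r
      where
      shift : ∀ k l → independentCount (suc k) (suc l) ≡ (q ℤ.^ suc l - 1ℤ) * q ℤ.^ k *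
          independentCount k l
      shift zero l = begin
        independentCount 1 (suc l)                        ≡⟨ independentCount-suc 0 (suc l) ⟩
        independentCount 0 (suc l) * (q ℤ.^ suc l - 1ℤ)
            ≡⟨ cong (_* (q ℤ.^ suc l - 1ℤ)) (independentCount-zero (suc l)) ⟩
        1ℤ * (q ℤ.^ suc l - 1ℤ)
            ≡⟨ solve 1 (λ a → con 1ℤ :* a := a :* con 1ℤ :* con 1ℤ) refl (q ℤ.^ suc l - 1ℤ) ⟩
        (q ℤ.^ suc l - 1ℤ) * 1ℤ * 1ℤ
          ≡⟨ cong ((q ℤ.^ suc l - 1ℤ) * 1ℤ *_) (independentCount-zero l) ⟨
        (q ℤ.^ suc l - 1ℤ) * 1ℤ * independentCount 0 l    ∎
        where open ℤ-Solver
      shift (suc k) l = begin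
        independentCount (suc (suc k)) (suc l)
          ≡⟨ independentCount-suc (suc k) (suc l) ⟩
        independentCount (suc k) (suc l) * (q ℤ.^ suc l - q ℤ.^ suc k)
          ≡⟨ cong (_* (q ℤ.^ suc l - q ℤ.^ suc k)) (shift k l) ⟩
        (q ℤ.^ suc l - 1ℤ) * q ℤ.^ k * independentCount k l * (q * q ℤ.^ l - q * q ℤ.^ k)
          ≡⟨ solve 5 (λ a b c q l → a :* b :* c :* (q :* l :- q :* b) := a :* (q :* b) :*
            (c :* (l :- b))) refl
               (q ℤ.^ suc l - 1ℤ) (q ℤ.^ k) (independentCount k l) q (q ℤ.^ l) ⟩
        (q ℤ.^ suc l - 1ℤ) * q ℤ.^ suc k * (independentCount k l * (q ℤ.^ l - q ℤ.^ k))
          ≡⟨ cong ((q ℤ.^ suc l - 1ℤ) * q ℤ.^ suc k *_) (independentCount-suc k l) ⟨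
        (q ℤ.^ suc l - 1ℤ) * q ℤ.^ suc k * independentCount (suc k) l ∎
        where open ℤ-Solver

  -- Reduction modulo a divisor

  module Reduction (n m : ℕ) .{{_ : NonZero n}} .{{_ : NonZero m}} (m∣n : m ∣ n) where

    private
      module ℤ/n = Residues n
      module ℤ/m = Residues m
      module N = Rows n
      module M = Rows m
      variable
        k l : ℕ

    π : Fin n → Fin m
    π x = toℕ x mod m

    πv : Vec (Fin n) l → Vec (Fin m) l
    πv = Vec.map π

    πM : Vec (Vec (Fin n) l) k → Vec (Vec (Fin m) l) k
    πM = Vec.map πv

    π-mod : ∀ a → π (a mod n) ≡ a mod m
    π-mod a = mod-cong m {toℕ (a mod n)} {a}
        (trans (cong (_% m) (toℕ-mod a n)) (m∣n⇒o%n%m≡o%m m n a m∣n))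

    π-⊕ : ∀ x y → π (x ℤ/n.⊕ y) ≡ π x ℤ/m.⊕ π y
    π-⊕ x y = trans (π-mod (toℕ x ℕ.+ toℕ y)) (ℤ/m.mod-+ (toℕ x) (toℕ y))

    π-⊗ : ∀ x y → π (x ℤ/n.⊗ y) ≡ π x ℤ/m.⊗ π y
    π-⊗ x y = trans (π-mod (toℕ x ℕ.* toℕ y)) (ℤ/m.mod-* (toℕ x) (toℕ y))

    π-neg : ∀ x → π (ℤ/n.neg x) ≡ ℤ/m.neg (π x)
    π-neg x = M.inverseˡ-unique (π (ℤ/n.neg x)) (π x)
      (trans (sym (π-⊕ (ℤ/n.neg x) x)) (trans (cong π (N.R.-‿inverseˡ x)) (π-mod 0)))

    π-sum : ∀ (f : Fin k → Fin n) → π (N.sum f) ≡ M.sum (π ∘ f)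
    π-sum {zero}  f = π-mod 0
    π-sum {suc k} f = trans (π-⊕ (f zero) (N.sum (f ∘ suc)))
        (cong (π (f zero) ℤ/m.⊕_) (π-sum (f ∘ suc)))

    lookup-πM : ∀ (X : Vec (Vec (Fin n) l) k) i j → lookup (lookup (πM X) i) j ≡ π
        (lookup (lookup X i) j)
    lookup-πM X i j = trans (cong (λ v → lookup v j) (lookup-map i πv X))
        (lookup-map j π (lookup X i))

    π-0v : πv (N.0v {l}) ≡ M.0v
    π-0v = lookup-ext λ i → trans (lookup-map i π N.0v)
        (trans (cong π (N.lookup-0v i)) (trans (π-mod 0) (sym (M.lookup-0v i))))

    π-⊛ : ∀ (c : Vec (Fin n) k) (X : Vec (Vec (Fin n) l) k) → πv (c N.⊛ X) ≡ πv c M.⊛ πM X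
    π-⊛ c X = lookup-ext λ j → begin
      lookup (πv (c N.⊛ X)) j
        ≡⟨ lookup-map j π (c N.⊛ X) ⟩
      π (lookup (c N.⊛ X) j)
        ≡⟨ trans (cong π (N.lookup-⊛ c X j)) (π-sum (λ i → lookup c i ℤ/n.⊗ lookup (lookup X i) j)) ⟩
      M.sum (λ i → π (lookup c i ℤ/n.⊗ lookup (lookup X i) j))
        ≡⟨ M.sum-cong-≗ (λ i → trans (π-⊗ (lookup c i) (lookup (lookup X i) j))
             (cong₂ ℤ/m._⊗_ (sym (lookup-map i π c)) (sym (lookup-πM X i j)))) ⟩
      M.sum (λ i → lookup (πv c) i ℤ/m.⊗ lookup (lookup (πM X) i) j)
        ≡⟨ M.lookup-⊛ (πv c) (πM X) j ⟨
      lookup (πv c M.⊛ πM X) j ∎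

    π-· : ∀ (X Y : Mat k n) → πM (X · Y) ≡ πM X · πM Y
    π-· X Y = begin
      πM (X · Y)                        ≡⟨ cong πM (N.·≡map-⊛ X Y) ⟩
      πM (Vec.map (N._⊛ Y) X)           ≡⟨ lookup-ext
          (λ i → trans (lookup-map i πv (Vec.map (N._⊛ Y) X))
                                             (trans (cong πv (lookup-map i (N._⊛ Y) X))
                                               (trans (π-⊛ (lookup X i) Y)
                                               (sym (trans (lookup-map i (M._⊛ πM Y) (πM X))
                                                 (cong (M._⊛ πM Y) (lookup-map i πv X))))))) ⟩
      Vec.map (M._⊛ πM Y) (πM X)        ≡⟨ M.·≡map-⊛ (πM X) (πM Y) ⟨
      πM X · πM Y                       ∎

    π-idMat : ∀ k → πM (idMat k n) ≡ idMat k m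
    π-idMat k = lookup-ext λ i → lookup-ext λ j → begin
      lookup (lookup (πM (idMat k n)) i) j              ≡⟨ lookup-πM (idMat k n) i j ⟩
      π (lookup (lookup (idMat k n) i) j)               ≡⟨ cong π (N.lookup-idMat k i j) ⟩
      π (if does (i Fin.≟ j) then ℤ/n.1# else ℤ/n.0#)   ≡⟨ π-if (does (i Fin.≟ j)) ⟩
      (if does (i Fin.≟ j) then ℤ/m.1# else ℤ/m.0#)     ≡⟨ M.lookup-idMat k i j ⟨
      lookup (lookup (idMat k m) i) j                   ∎
      where
      π-if : ∀ b → π (if b then ℤ/n.1# else ℤ/n.0#) ≡ (if b then ℤ/m.1# else ℤ/m.0#)
      π-if true  = π-mod 1
      π-if false = π-mod 0

    π-trace : ∀ (X : Mat k n) → π (N.trace X) ≡ M.trace (πM X)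
    π-trace X = trans (π-sum (λ i → entry X i i)) (M.sum-cong-≗ (λ i → sym (lookup-πM X i i)))

    π-superTrace : ∀ (X : Vec (Vec (Fin n) (suc k)) k) → π (N.superTrace X) ≡ M.superTrace (πM X)
    π-superTrace X = trans (π-sum (λ i → lookup (lookup X i) (suc i)))
        (M.sum-cong-≗ (λ i → sym (lookup-πM X i (suc i))))

    -- A row annihilated modulo `m` lifts only to a row that `X` sends to multiples of `m`, so
    -- independence does not descend directly. An inverse matrix does.
    π-independent : ∀ (X : Mat k n) → N.Independent X → M.Independent (πM X)
    π-independent {k} X indep = M.rightInverse⇒independent (πM X) (πM Y)
      (trans (sym (π-· X Y)) (trans (cong πM XY≡I) (π-idMat k)))
      where
      inv = N.IsGL⇒rightInverse X (N.independent⇒IsGL X indep)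
      Y = proj₁ inv
      XY≡I = proj₂ inv

    π-kernel : ∀ (X : Mat k n) → M.Independent (πM X) → ∀ c → c N.⊛ X ≡ N.0v → πv c ≡ M.0v
    π-kernel X indep c cX≡0 = indep (πv c) (trans (sym (π-⊛ c X)) (trans (cong πv cX≡0) π-0v))

    -- A section of `π` on representatives, in general not a ring homomorphism.
    lift : Fin m → Fin n
    lift x = toℕ x mod n

    π-lift : ∀ x → π (lift x) ≡ x
    π-lift x = trans (π-mod (toℕ x)) (mod-toℕ x)

  -- Coprime moduli

  %-≡⇒∣∣-∣ : ∀ x y n .{{_ : NonZero n}} → x % n ≡ y % n → n ∣ ℕ.∣ x - y ∣
  %-≡⇒∣∣-∣ x y n eq = divides ℕ.∣ x / n - y / n ∣ (begin
    ℕ.∣ x - y ∣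
        ≡⟨ cong₂ ℕ.∣_-_∣ (m≡m%n+[m/n]*n x n)
          (trans (m≡m%n+[m/n]*n y n) (cong (ℕ._+ (y / n) ℕ.* n) (sym eq))) ⟩
    ℕ.∣ x % n ℕ.+ (x / n) ℕ.* n - x % n ℕ.+ (y / n) ℕ.* n ∣  ≡⟨ ℕ.∣m+n-m+o∣≡∣n-o∣ (x % n) _ _ ⟩
    ℕ.∣ (x / n) ℕ.* n - (y / n) ℕ.* n ∣                      ≡⟨ ℕ.*-distribʳ-∣-∣ n (x / n) (y / n) ⟨
    ℕ.∣ x / n - y / n ∣ ℕ.* n                              ∎)

  coprime-∣-* : ∀ {a b d} → Coprime a b → a ∣ d → b ∣ d → a ℕ.* b ∣ d
  coprime-∣-* {a} {b} coprime (divides k refl) b∣ka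
    with divides j refl ← coprime-divisor (Coprime.sym coprime) (subst (b ∣_) (ℕ.*-comm k a) b∣ka)
    = divides j (trans (ℕ.*-assoc j b a) (cong (j ℕ.*_) (ℕ.*-comm b a)))

  module CRT (a b : ℕ) .{{_ : NonZero a}} .{{_ : NonZero b}} .{{_ : NonZero (a ℕ.* b)}}
      (coprime : Coprime a b) where

    private
      n = a ℕ.* b
      module A = Reduction n a (m∣m*n b)
      module B = Reduction n b (n∣m*n a)
      module RN = Rows n
      module RA = Rows a
      module RB = Rows b

    -- The distance of the two representatives is divisible by `a` and by `b`, hence by their
    -- product; being smaller than the product, it is zero.
    pair-≡ : ∀ {z z′} → A.π z ≡ A.π z′ → B.π z ≡ B.π z′ → z ≡ z′
    pair-≡ {z} {z′} eqA eqB = Fin.toℕ-injective (ℕ.∣m-n∣≡0⇒m≡n (begin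
      d         ≡⟨ m<n⇒m%n≡m (ℕ.≤-<-trans (ℕ.∣m-n∣≤m⊔n (toℕ z) (toℕ z′))
          (ℕ.⊔-lub (Fin.toℕ<n z) (Fin.toℕ<n z′))) ⟨
      d % n     ≡⟨ n∣m⇒m%n≡0 d n (coprime-∣-* coprime
                     (%-≡⇒∣∣-∣ (toℕ z) (toℕ z′) a (mod-injective a {toℕ z} {toℕ z′} eqA))
                     (%-≡⇒∣∣-∣ (toℕ z) (toℕ z′) b (mod-injective b {toℕ z} {toℕ z′} eqB))) ⟩
      0         ∎))
      where d = ℕ.∣ toℕ z - toℕ z′ ∣

    residue-split : SplitsAs (Enumeration.elems (fins n)) A.π B.π (Enumeration.elems (fins a))
        (Enumeration.elems (fins b))
    residue-split = splits (fins a) (fins b) (fins n) A.π B.π pair A-pair B-pair (λ _ _ → pair-≡)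
      where
      ub = coprime⇒inverse a (Coprime.sym coprime)
      va = coprime⇒inverse b coprime
      u = toℕ (proj₁ ub)
      v = toℕ (proj₁ va)
      -- The two idempotents: `u * b` is 1 modulo `a` and 0 modulo `b`, and `v * a` the other way
      -- round.
      pair : Fin a → Fin b → Fin n
      pair x y = (toℕ x ℕ.* (u ℕ.* b) ℕ.+ toℕ y ℕ.* (v ℕ.* a)) mod n
      idempotent : ∀ m .{{_ : NonZero m}} w k (x : Fin m) (y c : ℕ) → Residues._⊗_ m w (k mod m) ≡
          Residues.1# m →
                   (toℕ x ℕ.* (toℕ w ℕ.* k) ℕ.+ y ℕ.* (c ℕ.* m)) mod m ≡ x
      idempotent m w k x y c wk≡1 = begin
        (toℕ x ℕ.* (toℕ w ℕ.* k) ℕ.+ y ℕ.* (c ℕ.* m)) mod m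
          ≡⟨ mod-cong m (trans (cong (λ t → (toℕ x ℕ.* (toℕ w ℕ.* k) ℕ.+ t) % m)
            (sym (ℕ.*-assoc y c m)))
               ([m+kn]%n≡m%n (toℕ x ℕ.* (toℕ w ℕ.* k)) (y ℕ.* c) m)) ⟩
        (toℕ x ℕ.* (toℕ w ℕ.* k)) mod m
          ≡⟨ trans (mod-* (toℕ x) (toℕ w ℕ.* k))
            (cong₂ _⊗_ (mod-toℕ x) (trans (mod-* (toℕ w) k) (cong (_⊗ (k mod m)) (mod-toℕ w)))) ⟩
        x ⊗ (w ⊗ (k mod m))
          ≡⟨ trans (cong (x ⊗_) wk≡1) (R.*-identityʳ x) ⟩
        x ∎
        where
        open Residues m
        module R = CommutativeRing residueRing
      A-pair : ∀ x y → A.π (pair x y) ≡ x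
      A-pair x y = trans (A.π-mod _) (idempotent a (proj₁ ub) b x (toℕ y) v (proj₂ ub))
      B-pair : ∀ x y → B.π (pair x y) ≡ y
      B-pair x y = trans (B.π-mod _) (trans (cong (_mod b) (ℕ.+-comm (toℕ x ℕ.* (u ℕ.* b)) _))
                                            (idempotent b (proj₁ va) a y (toℕ x) u (proj₂ va)))

    pair-independent : ∀ {k} (X : Mat k n) → RA.Independent (A.πM X) → RB.Independent (B.πM X) →
        RN.Independent X
    pair-independent X indepA indepB c cX≡0 = lookup-ext λ i → pair-≡
      (component a A.π (A.π-kernel X indepA c cX≡0) A.π-0v i)
      (component b B.π (B.π-kernel X indepB c cX≡0) B.π-0v i)
      where
      component : ∀ m (π : Fin n → Fin m) {w} → Vec.map π c ≡ w → Vec.map π RN.0v ≡ w →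
                  ∀ i → π (lookup c i) ≡ π (lookup RN.0v i)
      component m π eq eq₀ i = trans (sym (lookup-map i π c))
        (trans (cong (λ v → lookup v i) (trans eq (sym eq₀))) (lookup-map i π RN.0v))

    traceCount-* : ∀ r t → RN.traceCount r t ≡ RA.traceCount r t * RB.traceCount r t
    traceCount-* r t = begin
      RN.traceCount r t
        ≡⟨ sumOver-cong (allMats r n) factor ⟩
      sumOver (allMats r n) (λ X → FA (A.πM X) * FB (B.πM X))
        ≡⟨ splits-vecs (splits-vecs residue-split r) r (λ U V → FA U * FB V) ⟩
      sumOver (allMats r a) (λ U → sumOver (allMats r b) (λ V → FA U * FB V))
        ≡⟨ sumOver-cong (allMats r a) (λ U → sumOver-*ˡ (allMats r b) (FA U) FB) ⟩
      sumOver (allMats r a) (λ U → FA U * RB.traceCount r t)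
        ≡⟨ sumOver-*ʳ (allMats r a) (RB.traceCount r t) FA ⟩
      RA.traceCount r t * RB.traceCount r t ∎
      where
      FA : Mat r a → ℤ
      FA U = ind (RA.independent? U) * ind (RA.trace U Fin.≟ (t mod a))
      FB : Mat r b → ℤ
      FB V = ind (RB.independent? V) * ind (RB.trace V Fin.≟ (t mod b))
      factor : ∀ X → ind (RN.independent? X) * ind (RN.trace X Fin.≟ (t mod n)) ≡ FA (A.πM X) * FB
          (B.πM X)
      factor X = begin
        ind (RN.independent? X) * ind (RN.trace X Fin.≟ (t mod n))
          ≡⟨ cong₂ _*_
               (trans (ind-cong (RN.independent? X)
                 (RA.independent? (A.πM X) ×-dec RB.independent? (B.πM X))
                        (λ i → A.π-independent X i , B.π-independent X i)
                          (λ (i , j) → pair-independent X i j))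
                      (ind-× (RA.independent? (A.πM X)) (RB.independent? (B.πM X))))
               (trans (ind-cong (RN.trace X Fin.≟ (t mod n))
                 ((RA.trace (A.πM X) Fin.≟ (t mod a)) ×-dec (RB.trace (B.πM X) Fin.≟ (t mod b)))
                        (λ eq → trans (sym (A.π-trace X)) (trans (cong A.π eq) (A.π-mod t))
                              , trans (sym (B.π-trace X)) (trans (cong B.π eq) (B.π-mod t)))
                        (λ (eqA , eqB) → pair-≡ (trans (A.π-trace X) (trans eqA (sym (A.π-mod t))))
                                                (trans (B.π-trace X) (trans eqB (sym
                                                  (B.π-mod t))))))
                      (ind-× (RA.trace (A.πM X) Fin.≟ (t mod a))
                        (RB.trace (B.πM X) Fin.≟ (t mod b)))) ⟩
        iA * iB * (tA * tB)
          ≡⟨ solve 4 (λ x y z w → x :* y :* (z :* w) := x :* z :* (y :* w)) refl iA iB tA tB ⟩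
        FA (A.πM X) * FB (B.πM X) ∎
        where
        open ℤ-Solver
        iA = ind (RA.independent? (A.πM X))
        iB = ind (RB.independent? (B.πM X))
        tA = ind (RA.trace (A.πM X) Fin.≟ (t mod a))
        tB = ind (RB.trace (B.πM X) Fin.≟ (t mod b))

  -- Lifting from modulus m to p m when p divides m

  Fibres : {C A : Set} → List C → (C → A) → List A → ℤ → Set
  Fibres {A = A} zs π xs c = ∀ (f : A → ℤ) → sumOver zs (f ∘ π) ≡ c * sumOver xs f

  -- Entries lift independently of each other, so the constant fibre size `c` of `π` is raised to
  -- the length of the vector.
  fibres-vecs : ∀ {C A : Set} {π : C → A} {zs xs c} → Fibres zs π xs c →
                ∀ k → Fibres (allVecs k zs) (Vec.map π) (allVecs k xs) (c ℤ.^ k)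
  fibres-vecs φ zero f = sym (ℤ.*-identityˡ _)
  fibres-vecs {π = π} {zs} {xs} {c} φ (suc k) f = begin
    sumOver (allVecs (suc k) zs) (f ∘ Vec.map π)
      ≡⟨ sumOver-allVecs k zs (f ∘ Vec.map π) ⟩
    sumOver zs (λ z → sumOver (allVecs k zs) (λ v → f (π z ∷ Vec.map π v)))
      ≡⟨ sumOver-cong zs (λ z → fibres-vecs φ k (λ w → f (π z ∷ w))) ⟩
    sumOver zs (λ z → c ℤ.^ k * sumOver (allVecs k xs) (λ w → f (π z ∷ w)))
      ≡⟨ sumOver-*ˡ zs (c ℤ.^ k) (λ z → sumOver (allVecs k xs) (λ w → f (π z ∷ w))) ⟩
    c ℤ.^ k * sumOver zs (λ z → sumOver (allVecs k xs) (λ w → f (π z ∷ w)))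
      ≡⟨ cong (c ℤ.^ k *_) (φ (λ x → sumOver (allVecs k xs) (λ w → f (x ∷ w)))) ⟩
    c ℤ.^ k * (c * sumOver xs (λ x → sumOver (allVecs k xs) (λ w → f (x ∷ w))))
      ≡⟨ trans (sym (ℤ.*-assoc (c ℤ.^ k) c _))
        (cong₂ _*_ (ℤ.*-comm (c ℤ.^ k) c) (sym (sumOver-allVecs k xs f))) ⟩
    c ℤ.^ suc k * sumOver (allVecs (suc k) xs) f ∎

  -- The trace condition determines the first diagonal entry from all the other entries.
  module TraceSum (n : ℕ) .{{_ : NonZero n}} where

    open Residues n
    open Rows n

    -- The weight `G` is arbitrary so that the same formula applies to the invertibility indicator
    -- modulo `m` and to its pullback along the reduction.
    sum-trace : ∀ s (G : Mat (suc s) n → ℤ) β →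
      sumOver (allMats (suc s) n) (λ X → G X * ind (trace X Fin.≟ β))
      ≡ Rowsₑ.sum s (λ w → sumOver (allVecs s (Rowsₑ.elems (suc s)))
          (λ X → G (((β ⊕ neg (superTrace X)) ∷ w) ∷ X)))
    sum-trace s G β = begin
      sumOver (allMats (suc s) n) (λ X → G X * ind (trace X Fin.≟ β))
        ≡⟨ sumOver-allVecs s (Rowsₑ.elems (suc s)) (λ X → G X * ind (trace X Fin.≟ β)) ⟩
      Rowsₑ.sum (suc s) (λ v → sumOver tails (λ X → G (v ∷ X) * ind (trace (v ∷ X) Fin.≟ β)))
        ≡⟨ sumOver-allVecs s P.elems (λ v → sumOver tails
          (λ X → G (v ∷ X) * ind (trace (v ∷ X) Fin.≟ β))) ⟩
      P.sum (λ x → Rowsₑ.sum s (λ w → sumOver tails (λ X → g x w X)))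
        ≡⟨ sumOver-swap P.elems (Rowsₑ.elems s) (λ x w → sumOver tails (λ X → g x w X)) ⟩
      Rowsₑ.sum s (λ w → P.sum (λ x → sumOver tails (λ X → g x w X)))
        ≡⟨ sumOver-cong (Rowsₑ.elems s) (λ w → sumOver-swap P.elems tails (λ x X → g x w X)) ⟩
      Rowsₑ.sum s (λ w → sumOver tails (λ X → P.sum (λ x → g x w X)))
        ≡⟨ sumOver-cong (Rowsₑ.elems s) (λ w → sumOver-cong tails (λ X → trans
             (sumOver-cong P.elems (λ x → trans (ℤ.*-comm (G ((x ∷ w) ∷ X)) _)
               (cong (_* G ((x ∷ w) ∷ X)) (ind-cong (x ⊕ superTrace X Fin.≟ β)
                 (x Fin.≟ (β ⊕ neg (superTrace X)))
                 (solve-entry (superTrace X) x) (check-entry (superTrace X) x)))))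
             (P.sum-pick (β ⊕ neg (superTrace X)) (λ x → G ((x ∷ w) ∷ X))))) ⟩
      Rowsₑ.sum s (λ w → sumOver tails (λ X → G (((β ⊕ neg (superTrace X)) ∷ w) ∷ X))) ∎
      where
      module P = Enumeration (fins n)
      tails = allVecs s (Rowsₑ.elems (suc s))
      g : Fin n → Row s → Vec (Row (suc s)) s → ℤ
      g x w X = G ((x ∷ w) ∷ X) * ind (x ⊕ superTrace X Fin.≟ β)
      solve-entry : ∀ t x → x ⊕ t ≡ β → x ≡ β ⊕ neg t
      solve-entry t x refl = sym (trans (R.+-assoc x t (neg t))
          (trans (cong (x ⊕_) (R.-‿inverseʳ t)) (R.+-identityʳ x)))
      check-entry : ∀ t x → x ≡ β ⊕ neg t → x ⊕ t ≡ β
      check-entry t x refl = trans (R.+-assoc β (neg t) t)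
          (trans (cong (β ⊕_) (R.-‿inverseˡ t)) (R.+-identityʳ β))

  module Lifting (p m : ℕ) .{{_ : NonZero p}} .{{_ : NonZero m}} .{{_ : NonZero (p ℕ.* m)}}
      (p∣m : p ∣ m) where

    private
      n = p ℕ.* m
      module N = Rows n
      module M = Rows m
      module ℤ/n = Residues n
      module ℤ/m = Residues m
      q = ℤ.+ p

    open Reduction n m (n∣m*n p)

    residue-fibres : Fibres (Enumeration.elems (fins n)) π (Enumeration.elems (fins m)) q
    residue-fibres f = begin
      sumOver (Enumeration.elems (fins n)) (f ∘ π)
        ≡⟨ splits (fins m) (fins p) (fins n) π ρ (λ x y → Fin.combine y x) π-combine
             (λ x y → cong proj₁ (Fin.remQuot-combine y x)) joint (λ x _ → f x) ⟩
      sumOver (Enumeration.elems (fins m)) (λ x → sumOver (Enumeration.elems (fins p)) (λ _ → f x))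
        ≡⟨ sumOver-cong (Enumeration.elems (fins m)) (λ x →
             trans (Enumeration.sum-const (fins p) (f x)) (cong (_* f x) (size-fins p))) ⟩
      sumOver (Enumeration.elems (fins m)) (λ x → q * f x)
        ≡⟨ sumOver-*ˡ (Enumeration.elems (fins m)) q f ⟩
      q * sumOver (Enumeration.elems (fins m)) f ∎
      where
      -- A residue modulo `p * m` is given by its quotient `ρ` and its remainder `π` on division by
      -- `m`; the quotient is free within a fibre of `π`.
      ρ : Fin n → Fin p
      ρ z = proj₁ (Fin.remQuot m z)
      π-combine : ∀ x y → π (Fin.combine y x) ≡ x
      π-combine x y = begin
        toℕ (Fin.combine y x) mod m       ≡⟨ cong (_mod m)
            (trans (Fin.toℕ-combine y x) (trans (ℕ.+-comm _ (toℕ x))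
              (cong (toℕ x ℕ.+_) (ℕ.*-comm m (toℕ y))))) ⟩
        (toℕ x ℕ.+ toℕ y ℕ.* m) mod m     ≡⟨ mod-cong m ([m+kn]%n≡m%n (toℕ x) (toℕ y) m) ⟩
        toℕ x mod m                       ≡⟨ mod-toℕ x ⟩
        x                                 ∎
      recover : ∀ z → Fin.combine (ρ z) (π z) ≡ z
      recover z = trans (cong (Fin.combine (ρ z))
          (trans (cong π (sym (Fin.combine-remQuot {p} m z)))
                          (π-combine (proj₂ (Fin.remQuot {p} m z)) (ρ z))))
                            (Fin.combine-remQuot {p} m z)
      joint : ∀ z z′ → π z ≡ π z′ → ρ z ≡ ρ z′ → z ≡ z′
      joint z z′ eqπ eqρ = trans (sym (recover z)) (trans (cong₂ Fin.combine eqρ eqπ) (recover z′))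

    row-fibres : ∀ k → Fibres (N.Rowsₑ.elems k) πv (M.Rowsₑ.elems k) (q ℤ.^ k)
    row-fibres = fibres-vecs {π = π} {xs = Enumeration.elems (fins m)} {c = q} residue-fibres

    -- The kernel of π annihilates itself because n = p m divides m².
    kernel-annihilates : ∀ c x y → π c ≡ ℤ/m.0# → π x ≡ π y → c ℤ/n.⊗ x ≡ c ℤ/n.⊗ y
    kernel-annihilates c x y πc≡0 πx≡πy
      with divides k c≡km ← m%n≡0⇒n∣m (toℕ c) m
          (trans (mod-injective m {toℕ c} {0} πc≡0) (m<n⇒m%n≡m (ℕ.>-nonZero⁻¹ m)))
      = mod-cong n (trans (expand k c≡km (toℕ x))
          (trans (cong (λ t → (k ℕ.* m ℕ.* t) % n) (mod-injective m {toℕ x} {toℕ y} πx≡πy))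
            (sym (expand k c≡km (toℕ y)))))
      where
      j = quotient p∣m
      expand : ∀ k → toℕ c ≡ k ℕ.* m → ∀ z → (toℕ c ℕ.* z) % n ≡ (k ℕ.* m ℕ.* (z % m)) % n
      expand k c≡km z = trans (cong (_% n) (begin
        toℕ c ℕ.* z
            ≡⟨ cong₂ ℕ._*_ c≡km (m≡m%n+[m/n]*n z m) ⟩
        k ℕ.* m ℕ.* (z % m ℕ.+ (z / m) ℕ.* m)
            ≡⟨ cong (λ m′ → k ℕ.* m ℕ.* (z % m ℕ.+ (z / m) ℕ.* m′)) (_∣_.equality p∣m) ⟩
        k ℕ.* m ℕ.* (z % m ℕ.+ (z / m) ℕ.* (j ℕ.* p))
            ≡⟨ solve 6 (λ k m j p r s → k :* m :* (r :+ s :* (j :* p))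
                                                                 := k :* m :* r :+ k :* s :* j :* (p :* m)) refl k m j p (z % m) (z / m) ⟩
        k ℕ.* m ℕ.* (z % m) ℕ.+ k ℕ.* (z / m) ℕ.* j ℕ.* n   ∎))
        ([m+kn]%n≡m%n (k ℕ.* m ℕ.* (z % m)) (k ℕ.* (z / m) ℕ.* j) n)
        where open ℕ-Solver

    -- Lift an inverse of `πM X` entrywise to `Y`, so that `X · Y` and the identity agree modulo
    -- `m`. A row `c` with `c ⊛ X` zero vanishes modulo `m`, hence cannot tell these two matrices
    -- apart, and `c` equals `(c ⊛ X) ⊛ Y`.
    lift-independent : ∀ {k} (X : Mat k n) → M.Independent (πM X) → N.Independent X
    lift-independent {k} X indep c cX≡0 = begin
      c                         ≡⟨ N.⊛-idMat c ⟨
      c N.⊛ idMat k n           ≡⟨ lookup-ext (λ j → trans (N.lookup-⊛ c (idMat k n) j) (trans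
                                     (N.sum-cong-≗ (λ i → kernel-annihilates (lookup c i) _ _
                                       (πc≡0 i) (π-entries i j)))
                                     (sym (N.lookup-⊛ c (X · Y) j)))) ⟩
      c N.⊛ (X · Y)             ≡⟨ cong (c N.⊛_) (N.·≡map-⊛ X Y) ⟩
      c N.⊛ Vec.map (N._⊛ Y) X  ≡⟨ N.⊛-assoc c X Y ⟨
      (c N.⊛ X) N.⊛ Y           ≡⟨ cong (N._⊛ Y) cX≡0 ⟩
      N.0v N.⊛ Y                ≡⟨ N.0v-⊛ Y ⟩
      N.0v                      ∎
      where
      inv = M.IsGL⇒rightInverse (πM X) (M.independent⇒IsGL (πM X) indep)
      Y = Vec.map (Vec.map lift) (proj₁ inv)
      πY : πM Y ≡ proj₁ inv
      πY = lookup-ext λ i → lookup-ext λ j → trans (lookup-πM Y i j) (trans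
        (cong π (trans (cong (λ v → lookup v j) (lookup-map i (Vec.map lift) (proj₁ inv)))
          (lookup-map j lift (lookup (proj₁ inv) i))))
        (π-lift _))
      πXY : πM (idMat k n) ≡ πM (X · Y)
      πXY = trans (π-idMat k) (trans (sym (proj₂ inv))
          (trans (cong (πM X ·_) (sym πY)) (sym (π-· X Y))))
      π-entries : ∀ i j → π (lookup (lookup (idMat k n) i) j) ≡ π (lookup (lookup (X · Y) i) j)
      π-entries i j = trans (sym (lookup-πM (idMat k n) i j))
          (trans (cong (λ Z → lookup (lookup Z i) j) πXY) (lookup-πM (X · Y) i j))
      πc≡0 : ∀ i → π (lookup c i) ≡ ℤ/m.0#
      πc≡0 i = trans (sym (lookup-map i π c))
          (trans (cong (λ v → lookup v i) (π-kernel X indep c cX≡0)) (M.lookup-0v i))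

    -- Invertibility depends only on the reduction modulo `m`. After the corner entry has been
    -- solved for from the trace, its reduction depends only on the reductions of the other entries,
    -- which lift freely.
    traceCount-lift : ∀ s b → N.traceCount (suc s) b ≡ q ℤ.^ (suc s ℕ.* suc s ℕ.∸ 1) * M.traceCount
        (suc s) b
    traceCount-lift s b = begin
      N.traceCount (suc s) b
        ≡⟨ sumOver-cong (allMats (suc s) n) (λ X → cong (_* ind (N.trace X Fin.≟ (b mod n)))
             (ind-cong (N.independent? X) (M.independent? (πM X)) (π-independent X)
               (lift-independent X))) ⟩
      sumOver (allMats (suc s) n) (λ X → G (πM X) * ind (N.trace X Fin.≟ (b mod n)))
        ≡⟨ TraceSum.sum-trace n s (G ∘ πM) (b mod n) ⟩
      N.Rowsₑ.sum s (λ w → sumOver (allVecs s (N.Rowsₑ.elems (suc s)))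
          (λ X → G (πM (((b mod n ℤ/n.⊕ ℤ/n.neg (N.superTrace X)) ∷ w) ∷ X))))
        ≡⟨ sumOver-cong (N.Rowsₑ.elems s) (λ w → sumOver-cong (allVecs s (N.Rowsₑ.elems (suc s)))
          (λ X →
             cong (λ x → G ((x ∷ πv w) ∷ πM X)) (trans (π-⊕ (b mod n) (ℤ/n.neg (N.superTrace X)))
               (cong₂ ℤ/m._⊕_ (π-mod b) (trans (π-neg (N.superTrace X))
                 (cong ℤ/m.neg (π-superTrace X))))))) ⟩
      N.Rowsₑ.sum s (λ w → sumOver (allVecs s (N.Rowsₑ.elems (suc s))) (λ X → H (πv w) (πM X)))
        ≡⟨ sumOver-cong (N.Rowsₑ.elems s) (λ w → fibres-vecs {c = q ℤ.^ suc s} (row-fibres (suc s))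
          s (H (πv w))) ⟩
      N.Rowsₑ.sum s (λ w → Q * sumOver tails (H (πv w)))
        ≡⟨ sumOver-*ˡ (N.Rowsₑ.elems s) Q (λ w → sumOver tails (H (πv w))) ⟩
      Q * N.Rowsₑ.sum s (λ w → sumOver tails (H (πv w)))
        ≡⟨ cong (Q *_) (row-fibres s (λ w → sumOver tails (H w))) ⟩
      Q * (q ℤ.^ s * M.Rowsₑ.sum s (λ w → sumOver tails (H w)))
        ≡⟨ cong (λ t → Q * (q ℤ.^ s * t)) (TraceSum.sum-trace m s G (b mod m)) ⟨
      Q * (q ℤ.^ s * M.traceCount (suc s) b)
        ≡⟨ trans (sym (ℤ.*-assoc Q (q ℤ.^ s) _)) (cong (_* M.traceCount (suc s) b) exponents) ⟩
      q ℤ.^ (suc s ℕ.* suc s ℕ.∸ 1) * M.traceCount (suc s) b ∎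
      where
      G : Mat (suc s) m → ℤ
      G X = ind (M.independent? X)
      H : Vec (Fin m) s → Vec (Vec (Fin m) (suc s)) s → ℤ
      H w X = G (((b mod m ℤ/m.⊕ ℤ/m.neg (M.superTrace X)) ∷ w) ∷ X)
      tails = allVecs s (M.Rowsₑ.elems (suc s))
      Q = (q ℤ.^ suc s) ℤ.^ s
      -- The free entries are `s` in the top row and `suc s` in each of the `s` rows below.
      exponents : Q * q ℤ.^ s ≡ q ℤ.^ (s ℕ.+ s ℕ.* suc s)
      exponents = begin
        Q * q ℤ.^ s                        ≡⟨ ℤ.*-comm Q _ ⟩
        q ℤ.^ s * Q                        ≡⟨ cong (q ℤ.^ s *_) (ℤ.^-*-assoc q (suc s) s) ⟩
        q ℤ.^ s * q ℤ.^ (suc s ℕ.* s)      ≡⟨ ℤ.^-distribˡ-+-* q s (suc s ℕ.* s) ⟨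
        q ℤ.^ (s ℕ.+ suc s ℕ.* s)          ≡⟨ cong (λ e → q ℤ.^ (s ℕ.+ e)) (ℕ.*-comm (suc s) s) ⟩
        q ℤ.^ (s ℕ.+ s ℕ.* suc s)          ∎

-- Rational products

open import Data.Rational using (ℚ; 0ℚ; 1ℚ; -_; _+_; _-_; _*_; toℚᵘ)

ι : ℤ → ℚ
ι i = i ℚ./ 1

-- Normalisation by a gcd blocks computation with variables in ℚ, so the laws of `ι` are verified on
-- unnormalised fractions.
toℚᵘ-ι : ∀ i → toℚᵘ (ι i) ℚᵘ.≃ ℚᵘ.mkℚᵘ i 0
toℚᵘ-ι i = ℚ.toℚᵘ-fromℚᵘ (ℚᵘ.mkℚᵘ i 0)

ι-* : ∀ i j → ι (i ℤ.* j) ≡ ι i * ι j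
ι-* i j = ℚ.toℚᵘ-injective (ℚᵘ.≃-trans (toℚᵘ-ι (i ℤ.* j)) (ℚᵘ.≃-sym
  (ℚᵘ.≃-trans (ℚ.toℚᵘ-homo-* (ι i) (ι j)) (ℚᵘ.*-cong (toℚᵘ-ι i) (toℚᵘ-ι j)))))

ι-+ : ∀ i j → ι (i ℤ.+ j) ≡ ι i + ι j
ι-+ i j = ℚ.toℚᵘ-injective (ℚᵘ.≃-trans (toℚᵘ-ι (i ℤ.+ j)) (ℚᵘ.≃-sym
  (ℚᵘ.≃-trans (ℚ.toℚᵘ-homo-+ (ι i) (ι j)) (ℚᵘ.≃-trans (ℚᵘ.+-cong (toℚᵘ-ι i) (toℚᵘ-ι j))
    (ℚᵘ.*≡* (cong (ℤ._* 1ℤ) (cong₂ ℤ._+_ (ℤ.*-identityʳ i) (ℤ.*-identityʳ j))))))))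

ι-neg : ∀ i → ι (ℤ.- i) ≡ - ι i
ι-neg i = ℚ.toℚᵘ-injective (ℚᵘ.≃-trans (toℚᵘ-ι (ℤ.- i)) (ℚᵘ.≃-sym
  (ℚᵘ.≃-trans (ℚ.toℚᵘ-homo‿- (ι i)) (ℚᵘ.-‿cong (toℚᵘ-ι i)))))

ι-- : ∀ i j → ι (i ℤ.- j) ≡ ι i - ι j
ι-- i j = trans (ι-+ i (ℤ.- j)) (cong (ι i +_) (ι-neg j))

ι-^ : ∀ i k → ι (i ℤ.^ k) ≡ ι i ^ℚ k
ι-^ i zero    = refl
ι-^ i (suc k) = trans (ι-* i (i ℤ.^ k)) (cong (ι i *_) (ι-^ i k))

reciprocal : ∀ d .{{_ : NonZero d}} → ((ℤ.+ 1) ℚ./ d) * ℕ→ℚ d ≡ 1ℚ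
reciprocal d@(suc d-1) = ℚ.toℚᵘ-injective
  (ℚᵘ.≃-trans (ℚ.toℚᵘ-homo-* ((ℤ.+ 1) ℚ./ d) (ℕ→ℚ d))
  (ℚᵘ.≃-trans (ℚᵘ.*-cong (ℚ.toℚᵘ-fromℚᵘ (ℚᵘ.mkℚᵘ (ℤ.+ 1) d-1)) (toℚᵘ-ι (ℤ.+ d)))
    (ℚᵘ.*≡* (solve 1 (λ x → con 1ℤ :* x :* con 1ℤ := con 1ℤ :* (x :* con 1ℤ)) refl (ℤ.+ d)))))
  where open ℤ-Solver

^ℚ-+ : ∀ x j k → x ^ℚ (j ℕ.+ k) ≡ x ^ℚ j * x ^ℚ k
^ℚ-+ x zero    k = sym (ℚ.*-identityˡ _)
^ℚ-+ x (suc j) k = trans (cong (x *_) (^ℚ-+ x j k)) (sym (ℚ.*-assoc x _ _))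

^ℚ-distribʳ-* : ∀ x y k → (x * y) ^ℚ k ≡ x ^ℚ k * y ^ℚ k
^ℚ-distribʳ-* x y zero    = refl
^ℚ-distribʳ-* x y (suc k) = trans (cong (x * y *_) (^ℚ-distribʳ-* x y k))
  (solve 4 (λ x y a b → x :* y :* (a :* b) := x :* a :* (y :* b)) refl x y (x ^ℚ k) (y ^ℚ k))
  where open ℚ-Solver

1^ℚ : ∀ k → 1ℚ ^ℚ k ≡ 1ℚ
1^ℚ zero    = refl
1^ℚ (suc k) = trans (ℚ.*-identityˡ _) (1^ℚ k)

ℕ→ℚ-* : ∀ a b → ℕ→ℚ (a ℕ.* b) ≡ ℕ→ℚ a * ℕ→ℚ b
ℕ→ℚ-* a b = trans (cong ι (ℤ.pos-* a b)) (ι-* (ℤ.+ a) (ℤ.+ b))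

ℕ→ℚ-^ : ∀ a k → ℕ→ℚ (a ℕ.^ k) ≡ ℕ→ℚ a ^ℚ k
ℕ→ℚ-^ a zero    = refl
ℕ→ℚ-^ a (suc k) = trans (ℕ→ℚ-* a (a ℕ.^ k)) (cong (ℕ→ℚ a *_) (ℕ→ℚ-^ a k))

pow*invPow : ∀ p .{{_ : NonZero p}} k → ℕ→ℚ p ^ℚ k * invPow p k ≡ 1ℚ
pow*invPow p k = trans (ℚ.*-comm (ℕ→ℚ p ^ℚ k) (invPow p k))
    (trans (cong (invPow p k *_) (sym (ℕ→ℚ-^ p k)))
  (reciprocal (p ℕ.^ k) {{ℕ.m^n≢0 p k}}))

*-cancelˡ : ∀ p .{{_ : NonZero p}} {x y} → ℕ→ℚ p * x ≡ ℕ→ℚ p * y → x ≡ y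
*-cancelˡ p {x} {y} eq = trans (sym (cancel x)) (trans (cong (((ℤ.+ 1) ℚ./ p) *_) eq) (cancel y))
  where
  cancel : ∀ z → ((ℤ.+ 1) ℚ./ p) * (ℕ→ℚ p * z) ≡ z
  cancel z = trans (sym (ℚ.*-assoc ((ℤ.+ 1) ℚ./ p) (ℕ→ℚ p) z))
      (trans (cong (_* z) (reciprocal p)) (ℚ.*-identityˡ z))

prodℚ-∷ʳ : ∀ xs x → prodℚ (xs List.∷ʳ x) ≡ prodℚ xs * x
prodℚ-∷ʳ []       x = trans (ℚ.*-identityʳ x) (sym (ℚ.*-identityˡ x))
prodℚ-∷ʳ (y ∷ xs) x = trans (cong (y *_) (prodℚ-∷ʳ xs x)) (sym (ℚ.*-assoc y (prodℚ xs) x))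

-- The product unfolds at its first factor, while induction on the upper bound adds the last one.
prod1to-suc : ∀ n f → prod1to (suc n) f ≡ prod1to n f * f (suc n)
prod1to-suc n f = begin
  prodℚ (List.map (f ∘ suc) (upTo (suc n)))
      ≡⟨ cong (prodℚ ∘ List.map (f ∘ suc)) (List.upTo-∷ʳ n) ⟨
  prodℚ (List.map (f ∘ suc) (upTo n List.∷ʳ n))
      ≡⟨ cong prodℚ (List.map-++ (f ∘ suc) (upTo n) (n ∷ [])) ⟩
  prodℚ (List.map (f ∘ suc) (upTo n) List.∷ʳ f (suc n))
      ≡⟨ prodℚ-∷ʳ (List.map (f ∘ suc) (upTo n)) (f (suc n)) ⟩
  prod1to n f * f (suc n)                             ∎

prod1to-cong : ∀ n {f g} → (∀ q .{{_ : NonZero q}} → f q ≡ g q) → prod1to n f ≡ prod1to n g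
prod1to-cong n eq = cong prodℚ (List.map-cong (λ i → eq (suc i)) (upTo n))

prod1to-* : ∀ n f g → prod1to n (λ q → f q * g q) ≡ prod1to n f * prod1to n g
prod1to-* zero    f g = refl
prod1to-* (suc n) f g = begin
  prod1to (suc n) (λ q → f q * g q)                       ≡⟨ prod1to-suc n (λ q → f q * g q) ⟩
  prod1to n (λ q → f q * g q) * (f (suc n) * g (suc n))
      ≡⟨ cong (_* (f (suc n) * g (suc n))) (prod1to-* n f g) ⟩
  prod1to n f * prod1to n g * (f (suc n) * g (suc n))
    ≡⟨ solve 4 (λ a b x y → a :* b :* (x :* y) := a :* x :* (b :* y)) refl (prod1to n f)
      (prod1to n g) (f (suc n)) (g (suc n)) ⟩
  prod1to n f * f (suc n) * (prod1to n g * g (suc n))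
      ≡⟨ cong₂ _*_ (prod1to-suc n f) (prod1to-suc n g) ⟨
  prod1to (suc n) f * prod1to (suc n) g                   ∎
  where open ℚ-Solver

prod1to-extend : ∀ {m n} f → m ≤ n → (∀ q → m < q → f q ≡ 1ℚ) → prod1to n f ≡ prod1to m f
prod1to-extend {m} f m≤n f≡1 = go (ℕ.≤⇒≤′ m≤n)
  where
  go : ∀ {n} → m ℕ.≤′ n → prod1to n f ≡ prod1to m f
  go ℕ.≤′-refl         = refl
  go {suc n} (ℕ.≤′-step m≤n) = begin
    prod1to (suc n) f         ≡⟨ prod1to-suc n f ⟩
    prod1to n f * f (suc n)   ≡⟨ cong₂ _*_ (go m≤n) (f≡1 (suc n) (s≤s (ℕ.≤′⇒≤ m≤n))) ⟩
    prod1to m f * 1ℚ          ≡⟨ ℚ.*-identityʳ _ ⟩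
    prod1to m f               ∎

prod1to-1 : ∀ n f → (∀ q → 0 < q → q ≤ n → f q ≡ 1ℚ) → prod1to n f ≡ 1ℚ
prod1to-1 zero    f f≡1 = refl
prod1to-1 (suc n) f f≡1 = trans (prod1to-suc n f)
  (cong₂ _*_ (prod1to-1 n f (λ q 0<q q≤n → f≡1 q 0<q (ℕ.m≤n⇒m≤1+n q≤n)))
    (f≡1 (suc n) (s≤s z≤n) ℕ.≤-refl))

-- With default 1 a filtered product becomes a product over a full range, and products over
-- different sets of primes can be compared factor by factor.
_⟪_⟫_ : ℚ → Dec P → ℚ → ℚ
x ⟪ d ⟫ y = if does d then x else y

pick-yes : ∀ (d : Dec P) {x y} → P → x ⟪ d ⟫ y ≡ x
pick-yes (yes _) p = refl
pick-yes (no ¬p) p = contradiction p ¬p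

pick-no : ∀ (d : Dec P) {x y} → ¬ P → x ⟪ d ⟫ y ≡ y
pick-no (yes p) ¬p = contradiction p ¬p
pick-no (no _)  ¬p = refl

pick-cong : ∀ (d : Dec P) (e : Dec P′) → (P → P′) → (P′ → P) → ∀ {x y} → x ⟪ d ⟫ y ≡ x ⟪ e ⟫ y
pick-cong (yes p) e to from = sym (pick-yes e (to p))
pick-cong (no ¬p) e to from = sym (pick-no e (¬p ∘ from))

prod1to-single : ∀ {p n} x → 0 < p → p ≤ n → prod1to n (λ q → x ⟪ q ℕ.≟ p ⟫ 1ℚ) ≡ x
prod1to-single {suc p} {n} x _ p≤n = begin
  prod1to n δ               ≡⟨ prod1to-extend δ p≤n (λ q p<q → pick-no (q ℕ.≟ suc p) (ℕ.>⇒≢ p<q)) ⟩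
  prod1to (suc p) δ         ≡⟨ prod1to-suc p δ ⟩
  prod1to p δ * δ (suc p)   ≡⟨ cong₂ _*_
      (prod1to-1 p δ (λ q _ q≤p → pick-no (q ℕ.≟ suc p) (ℕ.<⇒≢ (s≤s q≤p))))
        (pick-yes (suc p ℕ.≟ suc p) refl) ⟩
  1ℚ * x                    ≡⟨ ℚ.*-identityˡ x ⟩
  x                         ∎
  where
  δ : ℕ → ℚ
  δ q = x ⟪ q ℕ.≟ suc p ⟫ 1ℚ

prodℚ-filter : ∀ {P : A → Set} (P? : ∀ x → Dec (P x)) (g : A → ℚ) xs →
               prodℚ (List.map g (filter P? xs)) ≡ prodℚ (List.map (λ x → g x ⟪ P? x ⟫ 1ℚ) xs)
prodℚ-filter P? g []       = refl
prodℚ-filter P? g (x ∷ xs) with P? x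
... | yes _ = cong (g x *_) (prodℚ-filter P? g xs)
... | no _  = trans (prodℚ-filter P? g xs) (sym (ℚ.*-identityˡ _))

-- Products over primes

LocalFactor : Set
LocalFactor = (p : ℕ) → .{{NonZero p}} → ℚ

-- The value at 0, which is never used, is that of the corresponding functions in Defs.
total : LocalFactor → ℕ → ℚ
total f zero    = 0ℚ
total f (suc q) = f (suc q)

total-nonZero : ∀ (f : LocalFactor) p .{{_ : NonZero p}} → total f p ≡ f p
total-nonZero f zero    = contradiction refl (ℕ.≢-nonZero⁻¹ 0)
total-nonZero f (suc q) = refl

prodPrimes≡prod1to : ∀ m f → prodPrimes m f ≡ prod1to m
    (λ q → total f q ⟪ prime? q ×-dec (q ∣? m) ⟫ 1ℚ)
prodPrimes≡prod1to m f = begin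
  prodPrimes m f
    ≡⟨ cong prodℚ (List.map-cong (λ { zero → refl ; (suc q) → refl }) (primesDividing m)) ⟩
  prodℚ (List.map (total f) (primesDividing m))
    ≡⟨ prodℚ-filter (λ q → prime? q ×-dec (q ∣? m)) (total f) (List.map suc (upTo m)) ⟩
  prodℚ (List.map h (List.map suc (upTo m)))
    ≡⟨ cong prodℚ (List.map-∘ (upTo m)) ⟨
  prod1to m h ∎
  where
  h : ℕ → ℚ
  h q = total f q ⟪ prime? q ×-dec (q ∣? m) ⟫ 1ℚ

prodPrimesNotDividing≡prod1to : ∀ n l f → prodPrimesNotDividing n l f
  ≡ prod1to n (λ q → (total f q ⟪ ¬? (q ∣? l) ⟫ 1ℚ) ⟪ prime? q ×-dec (q ∣? n) ⟫ 1ℚ)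
prodPrimesNotDividing≡prod1to n l f = begin
  prodPrimesNotDividing n l f
    ≡⟨ cong prodℚ (List.map-cong (λ { zero → refl ; (suc q) → refl })
      (filter (λ q → ¬? (q ∣? l)) (primesDividing n))) ⟩
  prodℚ (List.map (total f) (filter (λ q → ¬? (q ∣? l)) (primesDividing n)))
    ≡⟨ prodℚ-filter (λ q → ¬? (q ∣? l)) (total f) (primesDividing n) ⟩
  prodℚ (List.map (λ q → total f q ⟪ ¬? (q ∣? l) ⟫ 1ℚ) (primesDividing n))
    ≡⟨ prodℚ-filter (λ q → prime? q ×-dec (q ∣? n)) (λ q → total f q ⟪ ¬? (q ∣? l) ⟫ 1ℚ)
      (List.map suc (upTo n)) ⟩
  prodℚ (List.map h (List.map suc (upTo n)))
    ≡⟨ cong prodℚ (List.map-∘ (upTo n)) ⟨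
  prod1to n h ∎
  where
  h : ℕ → ℚ
  h q = (total f q ⟪ ¬? (q ∣? l) ⟫ 1ℚ) ⟪ prime? q ×-dec (q ∣? n) ⟫ 1ℚ

module EulerProduct (f g : LocalFactor) (b : ℕ) where

  -- For a prime dividing `n`, dividing `gcd n b` and dividing `b` are equivalent. Testing `b` makes
  -- the factor independent of `n`, as an induction over the prime factors of `n` requires.
  factor : LocalFactor
  factor p = f p ⟪ p ∣? b ⟫ g p

  term : ℕ → ℕ → ℚ
  term n q = total factor q ⟪ prime? q ×-dec (q ∣? n) ⟫ 1ℚ

  eulerProduct : ℕ → ℚ
  eulerProduct n = prod1to n (term n)

  -- The product over the primes dividing the gcd is padded with ones up to `n`. Both products then
  -- have the same range, and each prime divisor of `n` contributes to exactly one of them.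
  merge : ∀ n .{{_ : NonZero n}} →
          prodPrimes (gcd n b) f * prodPrimesNotDividing n (gcd n b) g ≡ eulerProduct n
  merge n = begin
    prodPrimes l f * prodPrimesNotDividing n l g
      ≡⟨ cong₂ _*_ (trans (prodPrimes≡prod1to l f)
        (sym (prod1to-extend s (∣⇒≤ (gcd[m,n]∣m n b)) beyond)))
                   (prodPrimesNotDividing≡prod1to n l g) ⟩
    prod1to n s * prod1to n t
      ≡⟨ prod1to-* n s t ⟨
    prod1to n (λ q → s q * t q)
      ≡⟨ prod1to-cong n pointwise ⟩
    eulerProduct n ∎
    where
    l = gcd n b
    s t : ℕ → ℚ
    s q = total f q ⟪ prime? q ×-dec (q ∣? l) ⟫ 1ℚ
    t q = (total g q ⟪ ¬? (q ∣? l) ⟫ 1ℚ) ⟪ prime? q ×-dec (q ∣? n) ⟫ 1ℚ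
    l≢0 : NonZero l
    l≢0 = ℕ.≢-nonZero (gcd[m,n]≢0 n b (inj₁ (ℕ.≢-nonZero⁻¹ n)))
    beyond : ∀ q → l < q → s q ≡ 1ℚ
    beyond q l<q = pick-no (prime? q ×-dec (q ∣? l)) (λ (_ , q∣l) → ℕ.<⇒≱ l<q (∣⇒≤ {{l≢0}} q∣l))
    pointwise : ∀ q .{{_ : NonZero q}} → s q * t q ≡ term n q
    pointwise q = [ dividing , notDividing ]′ (toSum (prime? q ×-dec (q ∣? n)))
      where
      notDividing : ¬ (Prime q × q ∣ n) → s q * t q ≡ term n q
      notDividing ¬pn = trans (cong₂ _*_
        (pick-no (prime? q ×-dec (q ∣? l)) (λ (pr , q∣l) → ¬pn (pr , ∣-trans q∣l (gcd[m,n]∣m n b))))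
        (pick-no (prime? q ×-dec (q ∣? n)) ¬pn)) (sym (pick-no (prime? q ×-dec (q ∣? n)) ¬pn))
      dividing : Prime q × q ∣ n → s q * t q ≡ term n q
      dividing pn@(pr , q∣n) = [ inside , outside ]′ (toSum (q ∣? b))
        where
        inside : q ∣ b → s q * t q ≡ term n q
        inside q∣b = begin
          s q * t q
            ≡⟨ cong₂ _*_ (pick-yes (prime? q ×-dec (q ∣? l)) (pr , q∣l))
                         (trans (pick-yes (prime? q ×-dec (q ∣? n)) pn)
                           (pick-no (¬? (q ∣? l)) (λ q∤l → q∤l q∣l))) ⟩
          total f q * 1ℚ    ≡⟨ trans (ℚ.*-identityʳ _) (total-nonZero f q) ⟩
          f q               ≡⟨ pick-yes (q ∣? b) q∣b ⟨
          factor q          ≡⟨ trans (pick-yes (prime? q ×-dec (q ∣? n)) pn)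
              (total-nonZero factor q) ⟨
          term n q          ∎
          where
          q∣l : q ∣ l
          q∣l = gcd-greatest q∣n q∣b
        outside : q ∤ b → s q * t q ≡ term n q
        outside q∤b = begin
          s q * t q
            ≡⟨ cong₂ _*_ (pick-no (prime? q ×-dec (q ∣? l)) (q∤l ∘ proj₂))
                         (trans (pick-yes (prime? q ×-dec (q ∣? n)) pn)
                           (pick-yes (¬? (q ∣? l)) q∤l)) ⟩
          1ℚ * total g q    ≡⟨ trans (ℚ.*-identityˡ _) (total-nonZero g q) ⟩
          g q               ≡⟨ pick-no (q ∣? b) q∤b ⟨
          factor q          ≡⟨ trans (pick-yes (prime? q ×-dec (q ∣? n)) pn)
              (total-nonZero factor q) ⟨
          term n q          ∎
          where
          q∤l : q ∤ l
          q∤l q∣l = q∤b (∣-trans q∣l (gcd[m,n]∣n n b))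

  term-cong : ∀ {n m} q → (Prime q → q ∣ n → q ∣ m) → (Prime q → q ∣ m → q ∣ n) → term n q ≡ term m
      q
  term-cong {n} {m} q to from = pick-cong (prime? q ×-dec (q ∣? n)) (prime? q ×-dec (q ∣? m))
    (λ (pr , q∣n) → pr , to pr q∣n) (λ (pr , q∣m) → pr , from pr q∣m)

  module _ {p} (pp : Prime p) where

    private instance
      p≢0 : NonZero p
      p≢0 = prime⇒nonZero pp

    prime∣prime : ∀ {q} → Prime q → q ∣ p → q ≡ p
    prime∣prime pq q∣p with prime⇒irreducible pp q∣p
    ... | inj₁ refl = contradiction pq ¬prime[1]
    ... | inj₂ q≡p  = q≡p

    module _ (m : ℕ) .{{_ : NonZero m}} where

      private
        m≤pm : m ≤ p ℕ.* m
        m≤pm = ℕ.m≤n*m m p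
        beyond : ∀ q → m < q → term m q ≡ 1ℚ
        beyond q m<q = pick-no (prime? q ×-dec (q ∣? m)) (λ (_ , q∣m) → ℕ.<⇒≱ m<q (∣⇒≤ q∣m))

      -- No new prime divisor appears, so only the range of the product grows.
      eulerProduct-old : p ∣ m → eulerProduct (p ℕ.* m) ≡ eulerProduct m
      eulerProduct-old p∣m = trans (prod1to-cong (p ℕ.* m)
          (λ q → term-cong q forth (λ _ q∣m → ∣-trans q∣m (n∣m*n p))))
                                   (prod1to-extend (term m) m≤pm beyond)
        where
        forth : ∀ {q} → Prime q → q ∣ p ℕ.* m → q ∣ m
        forth pq q∣pm = [ (λ q∣p → subst (_∣ m) (sym (prime∣prime pq q∣p)) p∣m) , id ]′
            (euclidsLemma p m pq q∣pm)

      -- By Euclid's lemma `p` is the only new prime divisor; `δ` isolates its factor, while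
      -- `term m` is 1 at `p`.
      eulerProduct-new : p ∤ m → eulerProduct (p ℕ.* m) ≡ factor p * eulerProduct m
      eulerProduct-new p∤m = begin
        prod1to (p ℕ.* m) (term (p ℕ.* m))
          ≡⟨ prod1to-cong (p ℕ.* m) (λ q → pointwise q) ⟩
        prod1to (p ℕ.* m) (λ q → δ q * term m q)
          ≡⟨ prod1to-* (p ℕ.* m) δ (term m) ⟩
        prod1to (p ℕ.* m) δ * prod1to (p ℕ.* m) (term m)
          ≡⟨ cong₂ _*_ (prod1to-single (factor p) (ℕ.>-nonZero⁻¹ p) (ℕ.m≤m*n p m))
            (prod1to-extend (term m) m≤pm beyond) ⟩
        factor p * eulerProduct m ∎
        where
        δ : ℕ → ℚ
        δ q = factor p ⟪ q ℕ.≟ p ⟫ 1ℚ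
        pointwise : ∀ q → term (p ℕ.* m) q ≡ δ q * term m q
        pointwise q = [ new , old ]′ (toSum (q ℕ.≟ p))
          where
          new : q ≡ p → term (p ℕ.* m) q ≡ δ q * term m q
          new refl = begin
            term (p ℕ.* m) p      ≡⟨ trans (pick-yes (prime? p ×-dec (p ∣? (p ℕ.* m)))
                (pp , m∣m*n m)) (total-nonZero factor p) ⟩
            factor p              ≡⟨ ℚ.*-identityʳ _ ⟨
            factor p * 1ℚ         ≡⟨ cong₂ _*_ (pick-yes (p ℕ.≟ p) refl)
                (pick-no (prime? p ×-dec (p ∣? m)) (p∤m ∘ proj₂)) ⟨
            δ p * term m p        ∎
          old : q ≢ p → term (p ℕ.* m) q ≡ δ q * term m q
          old q≢p = begin
            term (p ℕ.* m) q      ≡⟨ term-cong q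
                                       (λ pq q∣pm → [ (λ q∣p → contradiction (prime∣prime pq q∣p)
                                         q≢p) , id ]′ (euclidsLemma p m pq q∣pm))
                                       (λ _ q∣m → ∣-trans q∣m (n∣m*n p)) ⟩
            term m q              ≡⟨ ℚ.*-identityˡ _ ⟨
            1ℚ * term m q         ≡⟨ cong (_* term m q) (pick-no (q ℕ.≟ p) q≢p) ⟨
            δ q * term m q        ∎

-- The formula at a prime modulus

module _ (r : ℕ) where

  divisorFactor nondivisorFactor : LocalFactor
  divisorFactor p = prod1to r (λ i → 1ℚ - invPow p i) +
      (((- 1ℚ) ^ℚ r) * invPow p ⌊ r ℕ.* (r ℕ.+ 1) /2⌋) * (ℕ→ℚ p - 1ℚ)
  nondivisorFactor p = prod1to r (λ i → 1ℚ - invPow p i) - ((- 1ℚ) ^ℚ r) * invPow p ⌊ r ℕ.*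
      (r ℕ.+ 1) /2⌋

module PrimeCase (p : ℕ) .{{_ : NonZero p}} (pp : Prime p) where

  open PrimeField p pp
  open Residues p using (0#)
  open Rows p using (traceCount)

  private
    p̂ = ℕ→ℚ p

  -- Write (r+1)² as (r+1) + r + r². The first power turns the new factor `1ℚ - invPow p (suc r)`
  -- into `p̂ ^ℚ suc r - 1ℚ`, and what results is the recursion `independentCount-square-suc`.
  pow-prod1to : ∀ r → p̂ ^ℚ (r ℕ.* r) * prod1to r (λ i → 1ℚ - invPow p i) ≡ ι (independentCount r r)
  pow-prod1to zero    = cong ι (sym (independentCount-zero 0))
  pow-prod1to (suc r) = begin
    p̂ ^ℚ (suc r ℕ.* suc r) * prod1to (suc r) u
      ≡⟨ cong₂ _*_ (trans (cong (p̂ ^ℚ_) (cong (suc r ℕ.+_) (ℕ.*-suc r r)))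
                   (trans (^ℚ-+ p̂ (suc r) (r ℕ.+ r ℕ.* r))
                     (cong (p̂ ^ℚ suc r *_) (^ℚ-+ p̂ r (r ℕ.* r)))))
                   (prod1to-suc r u) ⟩
    p̂ ^ℚ suc r * (p̂ ^ℚ r * p̂ ^ℚ (r ℕ.* r)) * (prod1to r u * (1ℚ - invPow p (suc r)))
      ≡⟨ solve 5 (λ a b c d v → a :* (b :* c) :* (d :* (con 1ℚ :- v)) := (a :- a :* v) :* b :*
        (c :* d)) refl
           (p̂ ^ℚ suc r) (p̂ ^ℚ r) (p̂ ^ℚ (r ℕ.* r)) (prod1to r u) (invPow p (suc r)) ⟩
    (p̂ ^ℚ suc r - p̂ ^ℚ suc r * invPow p (suc r)) * p̂ ^ℚ r * (p̂ ^ℚ (r ℕ.* r) * prod1to r u)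
      ≡⟨ cong₂ (λ x y → (p̂ ^ℚ suc r - x) * p̂ ^ℚ r * y) (pow*invPow p (suc r)) (pow-prod1to r) ⟩
    (p̂ ^ℚ suc r - 1ℚ) * p̂ ^ℚ r * ι (independentCount r r)
      ≡⟨ cong₂ (λ x y → (x - 1ℚ) * y * ι (independentCount r r)) (ι-^ q (suc r)) (ι-^ q r) ⟨
    (ι (q ℤ.^ suc r) - ι 1ℤ) * ι (q ℤ.^ r) * ι (independentCount r r)
      ≡⟨ cong (λ x → x * ι (q ℤ.^ r) * ι (independentCount r r)) (ι-- (q ℤ.^ suc r) 1ℤ) ⟨
    ι (q ℤ.^ suc r ℤ.- 1ℤ) * ι (q ℤ.^ r) * ι (independentCount r r)
      ≡⟨ trans (ι-* ((q ℤ.^ suc r ℤ.- 1ℤ) ℤ.* q ℤ.^ r) (independentCount r r))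
               (cong (_* ι (independentCount r r)) (ι-* (q ℤ.^ suc r ℤ.- 1ℤ) (q ℤ.^ r))) ⟨
    ι ((q ℤ.^ suc r ℤ.- 1ℤ) ℤ.* q ℤ.^ r ℤ.* independentCount r r)
      ≡⟨ cong ι (independentCount-square-suc r) ⟨
    ι (independentCount (suc r) (suc r)) ∎
    where
    open ℚ-Solver
    u : ℕ → ℚ
    u i = 1ℚ - invPow p i

  -- Here r(r-1)/2 and r(r+1)/2 add up to r². Halving is exact because r(r+1) is twice
  -- `triangle (suc r)`. This converts the exponent found by recursion into the negative one of the
  -- theorem.
  triangle-complement : ∀ r → triangle r ℕ.+ ⌊ r ℕ.* (r ℕ.+ 1) /2⌋ ≡ r ℕ.* r
  triangle-complement r = begin
    triangle r ℕ.+ ⌊ r ℕ.* (r ℕ.+ 1) /2⌋       ≡⟨ cong (λ x → triangle r ℕ.+ ⌊ x /2⌋) (double r) ⟨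
    triangle r ℕ.+ ⌊ t ℕ.+ t /2⌋               ≡⟨ cong (triangle r ℕ.+_) (ℕ.n≡⌊n+n/2⌋ t) ⟨
    triangle r ℕ.+ (triangle r ℕ.+ r)          ≡⟨ square r ⟩
    r ℕ.* r                                    ∎
    where
    t = triangle r ℕ.+ r
    square : ∀ r → triangle r ℕ.+ (triangle r ℕ.+ r) ≡ r ℕ.* r
    square zero    = refl
    square (suc r) = trans
      (solve 2 (λ t r → (t :+ r) :+ ((t :+ r) :+ (con 1 :+ r)) := con 1 :+ r :+ r :+
        (t :+ (t :+ r))) refl (triangle r) r)
      (trans (cong (suc r ℕ.+ r ℕ.+_) (square r))
        (solve 1 (λ r → con 1 :+ r :+ r :+ r :* r := (con 1 :+ r) :* (con 1 :+ r)) refl r))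
      where open ℕ-Solver
    double : ∀ r → (triangle r ℕ.+ r) ℕ.+ (triangle r ℕ.+ r) ≡ r ℕ.* (r ℕ.+ 1)
    double r = trans (solve 2 (λ t r → (t :+ r) :+ (t :+ r) := (t :+ (t :+ r)) :+ r) refl
        (triangle r) r)
      (trans (cong (ℕ._+ r) (square r)) (solve 1 (λ r → r :* r :+ r := r :* (r :+ con 1)) refl r))
      where open ℕ-Solver

  pow-invPow-triangle : ∀ r → p̂ ^ℚ (r ℕ.* r) * invPow p ⌊ r ℕ.* (r ℕ.+ 1) /2⌋ ≡ p̂ ^ℚ triangle r
  pow-invPow-triangle r = begin
    p̂ ^ℚ (r ℕ.* r) * invPow p e
        ≡⟨ cong (λ k → p̂ ^ℚ k * invPow p e) (triangle-complement r) ⟨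
    p̂ ^ℚ (triangle r ℕ.+ e) * invPow p e       ≡⟨ cong (_* invPow p e) (^ℚ-+ p̂ (triangle r) e) ⟩
    p̂ ^ℚ triangle r * p̂ ^ℚ e * invPow p e
        ≡⟨ ℚ.*-assoc (p̂ ^ℚ triangle r) (p̂ ^ℚ e) (invPow p e) ⟩
    p̂ ^ℚ triangle r * (p̂ ^ℚ e * invPow p e)    ≡⟨ cong (p̂ ^ℚ triangle r *_) (pow*invPow p e) ⟩
    p̂ ^ℚ triangle r * 1ℚ                       ≡⟨ ℚ.*-identityʳ _ ⟩
    p̂ ^ℚ triangle r                            ∎
    where e = ⌊ r ℕ.* (r ℕ.+ 1) /2⌋

  traceCount-factor : ∀ r .{{_ : NonZero r}} b →
    ι (traceCount r b) ≡ p̂ ^ℚ (r ℕ.* r ∸ 1) * EulerProduct.factor (divisorFactor r)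
        (nondivisorFactor r) b p
  -- Multiplying by `p` restores the scale of `traceCount-prime`; since `r` is positive, it also
  -- turns the exponent `r * r ∸ 1` into `r * r`.
  traceCount-factor r@(suc _) b = *-cancelˡ p (begin
    p̂ * ι (traceCount r b)
      ≡⟨ ι-* q (traceCount r b) ⟨
    ι (q ℤ.* traceCount r b)
      ≡⟨ cong ι (traceCount-prime r b) ⟩
    ι (independentCount r r ℤ.+ (ℤ.- 1ℤ) ℤ.^ r ℤ.* q ℤ.^ triangle r ℤ.* (q ℤ.* δ ℤ.- 1ℤ))
      ≡⟨ trans (ι-+ (independentCount r r) _) (cong (ι (independentCount r r) +_)
           (trans (ι-* ((ℤ.- 1ℤ) ℤ.^ r ℤ.* q ℤ.^ triangle r) (q ℤ.* δ ℤ.- 1ℤ))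
             (cong₂ _*_ (trans (ι-* ((ℤ.- 1ℤ) ℤ.^ r) (q ℤ.^ triangle r))
               (cong₂ _*_ (ι-^ (ℤ.- 1ℤ) r) (ι-^ q (triangle r))))
                        (trans (ι-- (q ℤ.* δ) 1ℤ) (cong (_- 1ℚ) (ι-* q δ)))))) ⟩
    ι (independentCount r r) + S * p̂ ^ℚ triangle r * (p̂ * ι δ - 1ℚ)
      ≡⟨ cong₂ (λ x y → x + S * y * (p̂ * ι δ - 1ℚ)) (pow-prod1to r) (pow-invPow-triangle r) ⟨
    W * Π + S * (W * v) * (p̂ * ι δ - 1ℚ)
      ≡⟨ solve 6 (λ w a s v p d → w :* a :+ s :* (w :* v) :* (p :* d :- con 1ℚ) := w :*
        (a :+ s :* v :* (p :* d :- con 1ℚ))) refl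
           W Π S v p̂ (ι δ) ⟩
    W * (Π + S * v * (p̂ * ι δ - 1ℚ))
      ≡⟨ cong (W *_) byCases ⟩
    W * factor
      ≡⟨ ℚ.*-assoc p̂ (p̂ ^ℚ (r ℕ.* r ∸ 1)) factor ⟩
    p̂ * (p̂ ^ℚ (r ℕ.* r ∸ 1) * factor) ∎)
    where
    open ℚ-Solver
    δ = ind (0# Fin.≟ (b mod p))
    S = (- 1ℚ) ^ℚ r
    v = invPow p ⌊ r ℕ.* (r ℕ.+ 1) /2⌋
    W = p̂ ^ℚ (r ℕ.* r)
    Π = prod1to r (λ i → 1ℚ - invPow p i)
    factor = EulerProduct.factor (divisorFactor r) (nondivisorFactor r) b p
    0%p≡0 : 0 % p ≡ 0
    0%p≡0 = m<n⇒m%n≡m (ℕ.>-nonZero⁻¹ p)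
    byCases : Π + S * v * (p̂ * ι δ - 1ℚ) ≡ factor
    byCases with p ∣? b
    ... | yes p∣b = begin
      Π + S * v * (p̂ * ι δ - 1ℚ)   ≡⟨ cong (λ d → Π + S * v * (p̂ * ι d - 1ℚ))
                                        (ind-yes (0# Fin.≟ (b mod p)) (mod-cong p {0} {b}
                                          (trans 0%p≡0 (sym (n∣m⇒m%n≡0 b p p∣b))))) ⟩
      Π + S * v * (p̂ * 1ℚ - 1ℚ)    ≡⟨ cong (λ x → Π + S * v * (x - 1ℚ)) (ℚ.*-identityʳ p̂) ⟩
      Π + S * v * (p̂ - 1ℚ)         ∎
    ... | no p∤b = begin
      Π + S * v * (p̂ * ι δ - 1ℚ)   ≡⟨ cong (λ d → Π + S * v * (p̂ * ι d - 1ℚ))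
                                        (ind-no (0# Fin.≟ (b mod p)) (λ eq → p∤b
                                          (m%n≡0⇒n∣m b p (trans (sym (mod-injective p {0} {b} eq))
                                            0%p≡0)))) ⟩
      Π + S * v * (p̂ * 0ℚ - 1ℚ)    ≡⟨ solve 3
          (λ a x p → a :+ x :* (p :* con 0ℚ :- con 1ℚ) := a :- x) refl Π (S * v) p̂ ⟩
      Π - S * v                    ∎

-- Induction over the prime factors

traceCount-one : ∀ r b → Rows.traceCount 1 r b ≡ 1ℤ
traceCount-one r b = begin
  traceCount r b
    ≡⟨ sumOver-cong (allMats r 1) (λ X → cong₂ ℤ._*_
         -- In the zero ring all rows are equal, so every matrix is independent and has the
         -- prescribed trace.
         (ind-yes (independent? X) (λ c _ → lookup-ext λ i → Fin1-unique _ _))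
         (ind-yes (trace X Fin.≟ (b mod 1)) (Fin1-unique _ _))) ⟩
  Enumeration.size (matrices r)
    ≡⟨ size-vecs (rows r) r ⟩
  Rowsₑ.size r ℤ.^ r
    ≡⟨ trans (cong (ℤ._^ r) (trans (size-vecs (fins 1) r) (ℤ.^-zeroˡ r))) (ℤ.^-zeroˡ r) ⟩
  1ℤ ∎
  where
  open Rows 1
  Fin1-unique : ∀ (x y : Fin 1) → x ≡ y
  Fin1-unique zero zero = refl

module _ (r : ℕ) .{{_ : NonZero r}} (b : ℕ) where

  open EulerProduct (divisorFactor r) (nondivisorFactor r) b

  -- Induction over the list of prime factors with repetition. A prime that occurs again in the rest
  -- of the list is handled by lifting, a prime that does not by the Chinese remainder theorem;
  -- either way it contributes its power to the front factor.
  traceCount-eulerProduct : ∀ ps → All Prime ps → ∀ n .{{_ : NonZero n}} → n ≡ product ps →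
    ι (Rows.traceCount n r b) ≡ ℕ→ℚ n ^ℚ (r ℕ.* r ∸ 1) * eulerProduct n
  traceCount-eulerProduct [] [] n refl = begin
    ι (Rows.traceCount 1 r b)   ≡⟨ cong ι (traceCount-one r b) ⟩
    1ℚ * (1ℚ * 1ℚ)              ≡⟨ cong₂ (λ x y → x * (1ℚ * y)) (1^ℚ E)
        (pick-no (prime? 1 ×-dec (1 ∣? 1)) {total factor 1} {1ℚ} (¬prime[1] ∘ proj₁)) ⟨
    1ℚ ^ℚ E * (1ℚ * term 1 1)   ≡⟨ cong (1ℚ ^ℚ E *_) (prod1to-suc 0 (term 1)) ⟨
    1ℚ ^ℚ E * eulerProduct 1    ∎
    where E = r ℕ.* r ∸ 1
  traceCount-eulerProduct (p ∷ ps) (pp ∷ pps) n refl = step (p ∣? m)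
    where
    E = r ℕ.* r ∸ 1
    m = product ps
    instance
      p≢0 : NonZero p
      p≢0 = prime⇒nonZero pp
      m≢0 : NonZero m
      m≢0 = ℕ.m*n≢0⇒n≢0 p
    IH : ι (Rows.traceCount m r b) ≡ ℕ→ℚ m ^ℚ E * eulerProduct m
    IH = traceCount-eulerProduct ps pps m refl
    powers : ℕ→ℚ (p ℕ.* m) ^ℚ E ≡ ℕ→ℚ p ^ℚ E * ℕ→ℚ m ^ℚ E
    powers = trans (cong (_^ℚ E) (ℕ→ℚ-* p m)) (^ℚ-distribʳ-* (ℕ→ℚ p) (ℕ→ℚ m) E)
    lifted : ∀ r .{{_ : NonZero r}} → p ∣ m → Rows.traceCount (p ℕ.* m) r b ≡ (ℤ.+ p) ℤ.^
        (r ℕ.* r ∸ 1) ℤ.* Rows.traceCount m r b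
    lifted (suc s) p∣m = Lifting.traceCount-lift p m p∣m s b
    step : Dec (p ∣ m) → ι (Rows.traceCount (p ℕ.* m) r b) ≡ ℕ→ℚ (p ℕ.* m) ^ℚ E * eulerProduct
        (p ℕ.* m)
    step (yes p∣m) = begin
      ι (Rows.traceCount (p ℕ.* m) r b)
        ≡⟨ trans (cong ι (lifted r p∣m)) (trans (ι-* ((ℤ.+ p) ℤ.^ E) (Rows.traceCount m r b))
          (cong₂ _*_ (ι-^ (ℤ.+ p) E) IH)) ⟩
      ℕ→ℚ p ^ℚ E * (ℕ→ℚ m ^ℚ E * eulerProduct m)
        ≡⟨ ℚ.*-assoc (ℕ→ℚ p ^ℚ E) (ℕ→ℚ m ^ℚ E) (eulerProduct m) ⟨
      ℕ→ℚ p ^ℚ E * ℕ→ℚ m ^ℚ E * eulerProduct m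
        ≡⟨ cong₂ _*_ powers (eulerProduct-old pp m p∣m) ⟨
      ℕ→ℚ (p ℕ.* m) ^ℚ E * eulerProduct (p ℕ.* m) ∎
    step (no p∤m) = begin
      ι (Rows.traceCount (p ℕ.* m) r b)
        ≡⟨ trans (cong ι (CRT.traceCount-* p m (Coprime.sym (prime∤⇒coprime pp p∤m)) r b))
                 (ι-* (Rows.traceCount p r b) (Rows.traceCount m r b)) ⟩
      ι (Rows.traceCount p r b) * ι (Rows.traceCount m r b)
        ≡⟨ cong₂ _*_ (PrimeCase.traceCount-factor p pp r b) IH ⟩
      ℕ→ℚ p ^ℚ E * factor p * (ℕ→ℚ m ^ℚ E * eulerProduct m)
        ≡⟨ solve 4 (λ a f c e → a :* f :* (c :* e) := a :* c :* (f :* e)) refl (ℕ→ℚ p ^ℚ E)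
          (factor p) (ℕ→ℚ m ^ℚ E) (eulerProduct m) ⟩
      ℕ→ℚ p ^ℚ E * ℕ→ℚ m ^ℚ E * (factor p * eulerProduct m)
        ≡⟨ cong₂ _*_ powers (eulerProduct-new pp m p∤m) ⟨
      ℕ→ℚ (p ℕ.* m) ^ℚ E * eulerProduct (p ℕ.* m) ∎
      where open ℚ-Solver

theorem8 : (n r : ℕ) .{{_ : NonZero n}} → 1 ≤ r → (β : Fin n) →
    let l = gcd n (toℕ β)
        e = ⌊ r ℕ.* (r ℕ.+ 1) /2⌋
    in ℕ→ℚ (Nβ r n β)
       ≡ (ℕ→ℚ n ^ℚ (r ℕ.* r ∸ 1))
         * prodPrimes l (λ p → prod1to r (λ i → 1ℚ - invPow p i)
                               + (((- 1ℚ) ^ℚ r) * invPow p e) * (ℕ→ℚ p - 1ℚ))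
         * prodPrimesNotDividing n l (λ p → prod1to r (λ i → 1ℚ - invPow p i)
                               - ((- 1ℚ) ^ℚ r) * invPow p e)
theorem8 n r@(suc _) (s≤s _) β = begin
  ι (ℤ.+ Nβ r n β)
    ≡⟨ cong ι (Rows.Nβ≡traceCount n r β) ⟩
  ι (Rows.traceCount n r b)
    ≡⟨ traceCount-eulerProduct r b (PrimeFactorisation.factors pf)
      (PrimeFactorisation.factorsPrime pf) n (PrimeFactorisation.isFactorisation pf) ⟩
  M * EulerProduct.eulerProduct f g b n
    ≡⟨ cong (M *_) (EulerProduct.merge f g b n) ⟨
  M * (prodPrimes (gcd n b) f * prodPrimesNotDividing n (gcd n b) g)
    ≡⟨ ℚ.*-assoc M (prodPrimes (gcd n b) f) (prodPrimesNotDividing n (gcd n b) g) ⟨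
  M * prodPrimes (gcd n b) f * prodPrimesNotDividing n (gcd n b) g ∎
  where
  b = toℕ β
  f g : LocalFactor
  f = divisorFactor r
  g = nondivisorFactor r
  M = ℕ→ℚ n ^ℚ (r ℕ.* r ∸ 1)
  pf = factorise n
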